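{- For every integer $N > 3$, \[ \theta(J(N,3)) = \begin{cases} 1, & N = 4,\\ 3, & N = 5,\\ \left\lfloor \frac{(N-1)^2}{4} \right\rfloor, & N > 5.\end{cases} \]
   Context: For integers $0<k<N$, let $[N]=\{1,\dots,N\}$ and let $\mathcal{P}_k([N])$ be the set of $k$-element subsets of $[N]$. The Johnson graph $J(N,k)$ has vertex set $\mathcal{P}_k([N])$, two vertices $S_1,S_2$ being adjacent iff $|S_1\cap S_2| = k-1$. A (vertex) clique cover of a graph $G$ is a collection of cliques of $G$ whose vertex sets together contain every vertex of $G$; $\theta(G)$ denotes the smallest cardinality of a clique cover of $G$. -}

module Defs where

open import Level using (0ℓ)
open import Data.Nat using (ℕ; _≤_; _∸_)
open import Data.Fin using (Fin)
open import Data.Fin.Subset using (Subset; ∣_∣; _∩_)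
open import Data.Product using (Σ; ∃; _×_)
open import Relation.Binary.PropositionalEquality using (_≡_; _≢_)

IsClique : {V : Set} → (V → V → Set) → (V → Set) → Set
IsClique {V} Adj C = ∀ (u v : V) → C u → C v → u ≢ v → Adj u v

record CliqueCover {V : Set} (Adj : V → V → Set) (m : ℕ) : Set₁ where
  field
    clique   : Fin m → V → Set
    isClique : ∀ i → IsClique Adj (clique i)
    covers   : ∀ (v : V) → ∃ λ i → clique i v

CliqueCoverNumber : {V : Set} → (V → V → Set) → ℕ → Set₁
CliqueCoverNumber Adj t =
  CliqueCover Adj t × (∀ m → CliqueCover Adj m → t ≤ m)

JVertex : ℕ → ℕ → Set
JVertex N k = Σ (Subset N) (λ S → ∣ S ∣ ≡ k)

JAdj : (N k : ℕ) → JVertex N k → JVertex N k → Set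
JAdj N k (S₁ Data.Product., _) (S₂ Data.Product., _) = ∣ S₁ ∩ S₂ ∣ ≡ k ∸ 1

{-# OPTIONS --safe #-}
-- Lower bound. Every clique of J(N,3) either has all its triples through one pair, or lies inside one
-- 4-set. Let H be the graph of the pairs not used by cliques of the first kind, with degrees d and
-- D = 2e(H), and let β be the number of cliques of the second kind; these must cover all triangles of H.
-- Counting by E(x,y) the pairs (Q, z) of such a 4-set Q and a point z with x, y, z distinct in Q,
--   24β = Σ E(x,y) ≥ Σ_{x~y} codeg(x,y) ≥ Σ_{x~y} (d x + d y - N) = 2 Σ d² - N D,
-- and (d - k)(d - k - 1) ≥ 0 for integers k bounds Σ d² from below by a linear function of D. Together
-- with 2(m - β) ≥ N(N-1) - D this suffices for N = 5 and N ≥ 8, with k near N/2. For N = 6 the bound at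
-- k = 4 would be attained with equality throughout, and for N = 7 nearly so; this is excluded by
-- the divisibility of E(x,y) by 2 and of Σ_y E(x,y) by 6.
--
-- Upper bound. Two of any three numbers have the same parity, so the pairs of equal parity give a cover
-- for N ≥ 6; for N = 5, use the 4-sets avoiding 0 or 1 and the pair {0,1}.

module Submission where

open import Data.Bool.Base using (Bool; true; false; not)
open import Data.Bool.Properties using (not-¬; not-involutive) renaming (_≟_ to _≟ᵇ_)
open import Data.Fin.Base using (Fin; zero; suc; toℕ)
import Data.Fin.Properties as Fin
open import Data.Fin.Subset using (Subset; inside; outside; ⁅_⁆; _∈_; _∉_; _⊆_; _∪_; _∩_)
open import Data.Fin.Subset.Properties
open import Data.Nat.Base as ℕ using (ℕ; zero; suc; z≤n; s≤s)
import Data.Nat.Properties as ℕ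
open import Data.Product using (∃; ∃₂; _×_; _,_; proj₁; proj₂)
open import Data.Sum using (_⊎_; inj₁; inj₂; [_,_]′)
open import Data.Vec.Properties using (≡-dec)
open import Defs
open import Function.Base using (_∘_)
open import Relation.Binary.PropositionalEquality using (_≡_; _≢_; refl; sym; trans; cong; cong₂; subst; ≢-sym; module ≡-Reasoning)
open import Relation.Nullary using (¬_; Dec; yes; no; does; contradiction; ¬?; _×-dec_; _⊎-dec_)
open import Relation.Nullary.Decidable using (decidable-stable; does-⇔; dec-false; from-no; from-yes; map′; toWitnessFalse)

-- Families of triples that pairwise share two points.

module Triples where
  open import Data.Fin.Subset using (⊥; ∣_∣)
  open import Data.Nat.Base using (_≤_; _<_)
  open import Data.Vec.Base using ([]; _∷_; lookup; here; there)

  ∣⁅x⁆∪p∣≡1+∣p∣ : ∀ {n} {x : Fin n} {p} → x ∉ p → ∣ ⁅ x ⁆ ∪ p ∣ ≡ suc ∣ p ∣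
  ∣⁅x⁆∪p∣≡1+∣p∣ {x = zero}  {inside  ∷ p} x∉p = contradiction here x∉p
  ∣⁅x⁆∪p∣≡1+∣p∣ {x = zero}  {outside ∷ p} x∉p = cong (suc ∘ ∣_∣) (∪-identityˡ p)
  ∣⁅x⁆∪p∣≡1+∣p∣ {x = suc x} {inside  ∷ p} x∉p = cong suc (∣⁅x⁆∪p∣≡1+∣p∣ (x∉p ∘ there))
  ∣⁅x⁆∪p∣≡1+∣p∣ {x = suc x} {outside ∷ p} x∉p = ∣⁅x⁆∪p∣≡1+∣p∣ (x∉p ∘ there)

  ∣⁅x⁆∪p∣≤1+∣p∣ : ∀ {n} (x : Fin n) p → ∣ ⁅ x ⁆ ∪ p ∣ ≤ suc ∣ p ∣
  ∣⁅x⁆∪p∣≤1+∣p∣ x p with x ∈? p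
  ... | no x∉p = ℕ.≤-reflexive (∣⁅x⁆∪p∣≡1+∣p∣ x∉p)
  ... | yes x∈p = ℕ.m≤n⇒m≤1+n (p⊆q⇒∣p∣≤∣q∣ (λ y∈ → [ (λ y∈⁅x⁆ → subst (_∈ p) (sym (x∈⁅y⁆⇒x≡y x y∈⁅x⁆)) x∈p) , (λ y∈p → y∈p) ]′ (x∈p∪q⁻ ⁅ x ⁆ p y∈)))

  ∈-∖ : ∀ {n} {S T : Subset n} → ∣ T ∣ < ∣ S ∣ → ∃ λ x → x ∈ S × x ∉ T
  ∈-∖ {S = S} {T} ∣T∣<∣S∣ with Fin.any? (λ x → (x ∈? S) ×-dec ¬? (x ∈? T))
  ... | yes p = p
  ... | no ¬p = contradiction (p⊆q⇒∣p∣≤∣q∣ (λ {x} x∈S → decidable-stable (x ∈? T) (λ x∉T → ¬p (x , x∈S , x∉T)))) (ℕ.<⇒≱ ∣T∣<∣S∣)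

  x∉⁅y⁆∪p⇒x≢y : ∀ {n} {x y : Fin n} {p} → x ∉ ⁅ y ⁆ ∪ p → x ≢ y
  x∉⁅y⁆∪p⇒x≢y {x = x} x∉ refl = x∉ (x∈p∪q⁺ (inj₁ (x∈⁅x⁆ x)))

  x∉p∪⁅y⁆⇒x≢y : ∀ {n} {x y : Fin n} {p} → x ∉ p ∪ ⁅ y ⁆ → x ≢ y
  x∉p∪⁅y⁆⇒x≢y {x = x} x∉ refl = x∉ (x∈p∪q⁺ (inj₂ (x∈⁅x⁆ x)))

  triple : ∀ {n} → Fin n → Fin n → Fin n → Subset n
  triple x y z = ⁅ x ⁆ ∪ (⁅ y ⁆ ∪ ⁅ z ⁆)

  module _ {n} {x y z w : Fin n} where

    ∈triple⁻ : w ∈ triple x y z → w ≡ x ⊎ w ≡ y ⊎ w ≡ z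
    ∈triple⁻ w∈ with x∈p∪q⁻ ⁅ x ⁆ _ w∈
    ... | inj₁ w∈x = inj₁ (x∈⁅y⁆⇒x≡y x w∈x)
    ... | inj₂ w∈yz with x∈p∪q⁻ ⁅ y ⁆ _ w∈yz
    ...   | inj₁ w∈y = inj₂ (inj₁ (x∈⁅y⁆⇒x≡y y w∈y))
    ...   | inj₂ w∈z = inj₂ (inj₂ (x∈⁅y⁆⇒x≡y z w∈z))

    ∈triple⁺ : w ≡ x ⊎ w ≡ y ⊎ w ≡ z → w ∈ triple x y z
    ∈triple⁺ (inj₁ refl)        = x∈p∪q⁺ (inj₁ (x∈⁅x⁆ x))
    ∈triple⁺ (inj₂ (inj₁ refl)) = x∈p∪q⁺ {p = ⁅ x ⁆} (inj₂ (x∈p∪q⁺ (inj₁ (x∈⁅x⁆ y))))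
    ∈triple⁺ (inj₂ (inj₂ refl)) = x∈p∪q⁺ {p = ⁅ x ⁆} (inj₂ (x∈p∪q⁺ {p = ⁅ y ⁆} (inj₂ (x∈⁅x⁆ z))))

  ∣triple∣≡3 : ∀ {n} {x y z : Fin n} → x ≢ y → x ≢ z → y ≢ z → ∣ triple x y z ∣ ≡ 3
  ∣triple∣≡3 {x = x} {y} {z} x≢y x≢z y≢z = trans (∣⁅x⁆∪p∣≡1+∣p∣ x∉yz)
    (cong suc (trans (∣⁅x⁆∪p∣≡1+∣p∣ (x≢y⇒x∉⁅y⁆ y≢z)) (cong suc (∣⁅x⁆∣≡1 z))))
    where
    x∉yz : x ∉ ⁅ y ⁆ ∪ ⁅ z ⁆
    x∉yz x∈ = [ (λ p → x≢y (x∈⁅y⁆⇒x≡y y p)) , (λ p → x≢z (x∈⁅y⁆⇒x≡y z p)) ]′ (x∈p∪q⁻ ⁅ y ⁆ _ x∈)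

  record Enumerates {n} (S : Subset n) (a b c : Fin n) : Set where
    constructor enumerates
    field
      ∣S∣≡3 : ∣ S ∣ ≡ 3
      a∈S : a ∈ S
      b∈S : b ∈ S
      c∈S : c ∈ S
      a≢b : a ≢ b
      a≢c : a ≢ c
      b≢c : b ≢ c

    -- A further member `x` would put the four-element set `⁅ x ⁆ ∪ triple a b c` inside `S`.
    complete : ∀ {x} → x ∈ S → x ≡ a ⊎ x ≡ b ⊎ x ≡ c
    complete {x} x∈S = ∈triple⁻ (decidable-stable (x ∈? triple a b c) λ x∉abc →
      ℕ.<⇒≱ (ℕ.≤-reflexive (sym (trans (∣⁅x⁆∪p∣≡1+∣p∣ x∉abc) (cong suc (trans (∣triple∣≡3 a≢b a≢c b≢c) (sym ∣S∣≡3))))))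
        (p⊆q⇒∣p∣≤∣q∣ (λ y∈ → [ (λ y∈x → subst (_∈ S) (sym (x∈⁅y⁆⇒x≡y x y∈x)) x∈S) , abc⊆S ]′ (x∈p∪q⁻ ⁅ x ⁆ _ y∈))))
      where
      abc⊆S : triple a b c ⊆ S
      abc⊆S y∈ with ∈triple⁻ y∈
      ... | inj₁ refl        = a∈S
      ... | inj₂ (inj₁ refl) = b∈S
      ... | inj₂ (inj₂ refl) = c∈S

    -- Comparing the size of `S ∩ T` with that of `⊥` and then of `⁅ y ⁆` yields two different
    -- members, which `complete` locates among `a`, `b`, `c`.
    two-common : ∀ {T} → 2 ≤ ∣ S ∩ T ∣ → (a ∈ T × b ∈ T) ⊎ (a ∈ T × c ∈ T) ⊎ (b ∈ T × c ∈ T)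
    two-common {T} 2≤ with ∈-∖ {T = ⊥} (subst (_< ∣ S ∩ T ∣) (sym (∣⊥∣≡0 n)) (ℕ.<-trans (s≤s z≤n) 2≤))
    ... | y , y∈ , _ with ∈-∖ {T = ⁅ y ⁆} (subst (_< ∣ S ∩ T ∣) (sym (∣⁅x⁆∣≡1 y)) 2≤)
    ...   | z , z∈ , z∉⁅y⁆ with x∈p∩q⁻ S T y∈ | x∈p∩q⁻ S T z∈
    ...     | y∈S , y∈T | z∈S , z∈T = cases (complete y∈S) (complete z∈S)
      where
      cases : y ≡ a ⊎ y ≡ b ⊎ y ≡ c → z ≡ a ⊎ z ≡ b ⊎ z ≡ c → (a ∈ T × b ∈ T) ⊎ (a ∈ T × c ∈ T) ⊎ (b ∈ T × c ∈ T)
      cases (inj₁ refl)        (inj₁ refl)        = contradiction (x∈⁅x⁆ y) z∉⁅y⁆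
      cases (inj₁ refl)        (inj₂ (inj₁ refl)) = inj₁ (y∈T , z∈T)
      cases (inj₁ refl)        (inj₂ (inj₂ refl)) = inj₂ (inj₁ (y∈T , z∈T))
      cases (inj₂ (inj₁ refl)) (inj₁ refl)        = inj₁ (z∈T , y∈T)
      cases (inj₂ (inj₁ refl)) (inj₂ (inj₁ refl)) = contradiction (x∈⁅x⁆ y) z∉⁅y⁆
      cases (inj₂ (inj₁ refl)) (inj₂ (inj₂ refl)) = inj₂ (inj₂ (y∈T , z∈T))
      cases (inj₂ (inj₂ refl)) (inj₁ refl)        = inj₂ (inj₁ (z∈T , y∈T))
      cases (inj₂ (inj₂ refl)) (inj₂ (inj₁ refl)) = inj₂ (inj₂ (z∈T , y∈T))
      cases (inj₂ (inj₂ refl)) (inj₂ (inj₂ refl)) = contradiction (x∈⁅x⁆ y) z∉⁅y⁆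

  swap₁₂ : ∀ {n} {S : Subset n} {a b c} → Enumerates S a b c → Enumerates S b a c
  swap₁₂ (enumerates s a∈ b∈ c∈ a≢b a≢c b≢c) = enumerates s b∈ a∈ c∈ (≢-sym a≢b) b≢c a≢c

  swap₂₃ : ∀ {n} {S : Subset n} {a b c} → Enumerates S a b c → Enumerates S a c b
  swap₂₃ (enumerates s a∈ b∈ c∈ a≢b a≢c b≢c) = enumerates s a∈ c∈ b∈ a≢c a≢b (≢-sym b≢c)

  ∣⁅x⁆∪⁅y⁆∣≤2 : ∀ {n} (x y : Fin n) → ∣ ⁅ x ⁆ ∪ ⁅ y ⁆ ∣ ≤ 2
  ∣⁅x⁆∪⁅y⁆∣≤2 x y = ℕ.≤-trans (∣⁅x⁆∪p∣≤1+∣p∣ x ⁅ y ⁆) (s≤s (ℕ.≤-reflexive (∣⁅x⁆∣≡1 y)))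

  third : ∀ {n} {S : Subset n} {a b} → ∣ S ∣ ≡ 3 → a ∈ S → b ∈ S → a ≢ b → ∃ λ c → Enumerates S a b c
  third {S = S} {a} {b} ∣S∣≡3 a∈S b∈S a≢b with ∈-∖ {T = ⁅ a ⁆ ∪ ⁅ b ⁆} (subst (_ <_) (sym ∣S∣≡3) (s≤s (∣⁅x⁆∪⁅y⁆∣≤2 a b)))
  ... | c , c∈S , c∉ = c , enumerates ∣S∣≡3 a∈S b∈S c∈S a≢b (≢-sym (x∉⁅y⁆∪p⇒x≢y c∉)) (≢-sym (x∉p∪⁅y⁆⇒x≢y c∉))

  enumerate : ∀ {n} {S : Subset n} → ∣ S ∣ ≡ 3 → ∃₂ λ a b → ∃ λ c → Enumerates S a b c
  enumerate {n} {S} ∣S∣≡3 with ∈-∖ {T = ⊥} (subst (_ <_) (sym ∣S∣≡3) (s≤s (ℕ.≤-trans (ℕ.≤-reflexive (∣⊥∣≡0 n)) z≤n)))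
  ... | a , a∈S , _ with ∈-∖ {T = ⁅ a ⁆} (subst (_ <_) (sym ∣S∣≡3) (s≤s (ℕ.≤-trans (ℕ.≤-reflexive (∣⁅x⁆∣≡1 a)) (s≤s z≤n))))
  ...   | b , b∈S , b∉⁅a⁆ = a , b , third ∣S∣≡3 a∈S b∈S (≢-sym (x∉⁅y⁆⇒x≢y b∉⁅a⁆))

  -- Decidable membership lets the classification search all subsets for a counterexample. `meet` is
  -- an inequality so that it also holds for `S = T`.
  record TripleFamily {n} (M : Subset n → Set) : Set where
    field
      member? : ∀ S → Dec (M S)
      size    : ∀ {S} → M S → ∣ S ∣ ≡ 3
      meet    : ∀ {S T} → M S → M T → 2 ≤ ∣ S ∩ T ∣

  -- A quad is given by a map from `Fin 4`, possibly not injective: a constant map serves the empty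
  -- family, and later counts run over indices, so they come out the same for every map.
  data Shape {n} (M : Subset n → Set) : Set where
    common-pair : ∀ p q → p ≢ q → (∀ {S} → M S → p ∈ S × q ∈ S) → Shape M
    within-quad : (V : Fin 4 → Fin n) → (∀ {S} → M S → ∀ {x} → x ∈ S → ∃ λ i → V i ≡ x) → Shape M

  module _ {n} {M : Subset n → Set} (F : TripleFamily M) where
    open TripleFamily F

    -- A member has two points in each of `abc`, `acd`, `abd`. The pairs that occur force three of
    -- its points to be among `a`, `b`, `c`, `d`, and it has no others.
    covered-by-quad : ∀ {S₀ S₁ S₂ a b c d} → M S₀ → M S₁ → M S₂ →
      Enumerates S₀ a b c → Enumerates S₁ a c d → Enumerates S₂ a b d → Shape M
    covered-by-quad {a = a} {b} {c} {d} m₀ m₁ m₂ e₀ e₁ e₂ = within-quad (lookup (a ∷ b ∷ c ∷ d ∷ [])) contained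
      where
      module e₀ = Enumerates e₀
      module e₁ = Enumerates e₁
      module e₂ = Enumerates e₂
      a' b' c' d' : Fin 4
      a' = zero
      b' = suc zero
      c' = suc (suc zero)
      d' = suc (suc (suc zero))
      V : Fin 4 → Fin n
      V = lookup (a ∷ b ∷ c ∷ d ∷ [])
      from : ∀ {S x} i j k → V i ≢ V j → V i ≢ V k → V j ≢ V k → M S → V i ∈ S → V j ∈ S → V k ∈ S → x ∈ S → ∃ λ i → V i ≡ x
      from i j k i≢j i≢k j≢k m i∈ j∈ k∈ x∈ with Enumerates.complete (enumerates (size m) i∈ j∈ k∈ i≢j i≢k j≢k) x∈
      ... | inj₁ refl        = i , refl
      ... | inj₂ (inj₁ refl) = j , refl
      ... | inj₂ (inj₂ refl) = k , refl
      contained : ∀ {S} → M S → ∀ {x} → x ∈ S → ∃ λ i → V i ≡ x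
      contained m x∈ with e₀.two-common (meet m₀ m) | e₁.two-common (meet m₁ m) | e₂.two-common (meet m₂ m)
      ... | inj₁ (a∈ , b∈)        | inj₁ (_ , c∈)         | _ = from a' b' c' e₀.a≢b e₀.a≢c e₀.b≢c m a∈ b∈ c∈ x∈
      ... | inj₁ (a∈ , b∈)        | inj₂ (inj₁ (_ , d∈))  | _ = from a' b' d' e₀.a≢b e₁.a≢c e₂.b≢c m a∈ b∈ d∈ x∈
      ... | inj₁ (a∈ , b∈)        | inj₂ (inj₂ (c∈ , _))  | _ = from a' b' c' e₀.a≢b e₀.a≢c e₀.b≢c m a∈ b∈ c∈ x∈
      ... | inj₂ (inj₂ (b∈ , c∈)) | inj₁ (a∈ , _)         | _ = from a' b' c' e₀.a≢b e₀.a≢c e₀.b≢c m a∈ b∈ c∈ x∈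
      ... | inj₂ (inj₂ (b∈ , c∈)) | inj₂ (inj₁ (a∈ , _))  | _ = from a' b' c' e₀.a≢b e₀.a≢c e₀.b≢c m a∈ b∈ c∈ x∈
      ... | inj₂ (inj₂ (b∈ , c∈)) | inj₂ (inj₂ (_ , d∈))  | _ = from b' c' d' e₀.b≢c e₂.b≢c e₁.b≢c m b∈ c∈ d∈ x∈
      -- The pair `a`, `c` lies in `S₁` too, so `S₁` need not give a third point; `S₂` does.
      ... | inj₂ (inj₁ (a∈ , c∈)) | _ | inj₁ (_ , b∈)         = from a' b' c' e₀.a≢b e₀.a≢c e₀.b≢c m a∈ b∈ c∈ x∈
      ... | inj₂ (inj₁ (a∈ , c∈)) | _ | inj₂ (inj₁ (_ , d∈))  = from a' c' d' e₀.a≢c e₁.a≢c e₁.b≢c m a∈ c∈ d∈ x∈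
      ... | inj₂ (inj₁ (a∈ , c∈)) | _ | inj₂ (inj₂ (b∈ , _))  = from a' b' c' e₀.a≢b e₀.a≢c e₀.b≢c m a∈ b∈ c∈ x∈

    common? : ∀ p q → (∃ λ S → M S × ¬ (p ∈ S × q ∈ S)) ⊎ (∀ {S} → M S → p ∈ S × q ∈ S)
    common? p q with anySubset? (λ S → member? S ×-dec ¬? ((p ∈? S) ×-dec (q ∈? S)))
    ... | yes e = inj₁ e
    ... | no ¬e = inj₂ (λ {S} m → decidable-stable ((p ∈? S) ×-dec (q ∈? S)) (λ ¬pq → ¬e (S , m , ¬pq)))

    -- Here `S₀ = abc` and `S₁ = acd`. A member missing `a` or `c` must meet both in two points, so
    -- it is `abd` or `cbd`; the second case is the first with `a` and `c` exchanged.
    shape-from-two : ∀ {S₀ S₁ a b c} → M S₀ → Enumerates S₀ a b c → M S₁ → a ∈ S₁ → c ∈ S₁ → b ∉ S₁ → Shape M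
    shape-from-two {a = a} {b} {c} m₀ e₀ m₁ a∈S₁ c∈S₁ b∉S₁ with third (size m₁) a∈S₁ c∈S₁ (Enumerates.a≢c e₀) | common? a c
    ... | _ | inj₂ all = common-pair a c (Enumerates.a≢c e₀) all
    ... | d , e₁ | inj₁ (S₂ , m₂ , ¬ac) with Enumerates.two-common e₀ (meet m₀ m₂) | Enumerates.two-common e₁ (meet m₁ m₂)
    ...   | inj₂ (inj₁ ac)        | _                     = contradiction ac ¬ac
    ...   | _                     | inj₁ ac               = contradiction ac ¬ac
    ...   | inj₁ (a∈ , b∈)        | inj₂ (inj₂ (c∈ , d∈)) = contradiction (a∈ , c∈) ¬ac
    ...   | inj₂ (inj₂ (b∈ , c∈)) | inj₂ (inj₁ (a∈ , d∈)) = contradiction (a∈ , c∈) ¬ac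
    ...   | inj₁ (a∈ , b∈)        | inj₂ (inj₁ (_ , d∈))  = covered-by-quad m₀ m₁ m₂ e₀ e₁
      (enumerates (size m₂) a∈ b∈ d∈ (Enumerates.a≢b e₀) (Enumerates.a≢c e₁) (λ { refl → b∉S₁ (Enumerates.c∈S e₁) }))
    ...   | inj₂ (inj₂ (b∈ , c∈)) | inj₂ (inj₂ (_ , d∈))  = covered-by-quad m₀ m₁ m₂ (swap₁₂ (swap₂₃ (swap₁₂ e₀))) (swap₁₂ e₁)
      (enumerates (size m₂) c∈ b∈ d∈ (≢-sym (Enumerates.b≢c e₀)) (Enumerates.b≢c e₁) (λ { refl → b∉S₁ (Enumerates.c∈S e₁) }))

    shape : Fin n → Shape M
    shape o with anySubset? member?
    -- The point `o` is only a default, for the empty family.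
    ... | no ¬m = within-quad (λ _ → o) (λ m → contradiction (_ , m) ¬m)
    ... | yes (S₀ , m₀) with enumerate (size m₀)
    ...   | a , b , c , e₀ with common? a b
    ...     | inj₂ all = common-pair a b (Enumerates.a≢b e₀) all
    ...     | inj₁ (S₁ , m₁ , ¬ab) with Enumerates.two-common e₀ (meet m₀ m₁)
    ...       | inj₁ ab               = contradiction ab ¬ab
    ...       | inj₂ (inj₁ (a∈ , c∈)) = shape-from-two m₀ e₀ m₁ a∈ c∈ (λ b∈ → ¬ab (a∈ , b∈))
    ...       | inj₂ (inj₂ (b∈ , c∈)) = shape-from-two m₀ (swap₁₂ e₀) m₁ b∈ c∈ (λ a∈ → ¬ab (a∈ , b∈))

module Weights where
  open Triples
  open import Data.Integer.Properties
  open import Algebra.Properties.Semiring.Sum +-*-semiring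
    using (sum; sum-syntax; sum-cong-≗; ∑-comm; *-distribˡ-sum; *-distribʳ-sum) renaming (∑-distrib-+ to sum-+)
  open import Data.Fin.Subset using () renaming (∣_∣ to card)
  open import Data.Empty using (⊥; ⊥-elim)
  open import Data.Integer.Base using (ℤ; +_; -[1+_]; 0ℤ; 1ℤ; _+_; _*_; _-_; -_; _≤_; _<_; +≤+; -≤+; -<+; ∣_∣)
  open import Data.Integer.Tactic.RingSolver using (solve-∀)
  open import Data.Nat.Divisibility using (_∣_; _∣?_; m∣m*n)
  open import Function.Bundles using (mk⇔)

  -- Certificates for integer inequalities.

  infixl 6 _⊕_
  infixl 7 _⊙_

  _⊕_ : ∀ {i j} → 0ℤ ≤ i → 0ℤ ≤ j → 0ℤ ≤ i + j
  _⊕_ = +-mono-≤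

  0≤* : ∀ {i j} → 0ℤ ≤ i → 0ℤ ≤ j → 0ℤ ≤ i * j
  0≤* {+ i} {+ j} (+≤+ _) (+≤+ _) = subst (0ℤ ≤_) (pos-* i j) (+≤+ z≤n)

  _⊙_ : ∀ (c : ℕ) {j} → 0ℤ ≤ j → 0ℤ ≤ + c * j
  c ⊙ p = 0≤* {+ c} (+≤+ z≤n) p

  -- Inequalities are proved by certificates: nonnegative terms are added with `⊕`, scaled with `⊙`,
  -- and `by` rewrites the total along a ring identity.
  _by_ : ∀ {i j} → 0ℤ ≤ i → i ≡ j → 0ℤ ≤ j
  p by eq = subst (0ℤ ≤_) eq p
  infix 5 _by_

  0≰-[1+_] : ∀ n → ¬ 0ℤ ≤ -[1+ n ]
  0≰-[1+ n ] ()

  -- The second alternative records `i < 0` as `i ≤ -1`, so the unit gained from integrality enters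
  -- the certificates.
  0≤-or-neg : ∀ i → 0ℤ ≤ i ⊎ 0ℤ ≤ - i - 1ℤ
  0≤-or-neg (+ n)    = inj₁ (+≤+ z≤n)
  0≤-or-neg -[1+ n ] = inj₂ (+≤+ z≤n)

  0≤c*i⇒0≤i : ∀ c {i} → 0ℤ ≤ + suc c * i → 0ℤ ≤ i
  0≤c*i⇒0≤i c {+ n}      _ = +≤+ z≤n

  -- No integer lies strictly between 0 and 1, so the two factors never have opposite signs.
  consecutive-product≥0 : ∀ i → 0ℤ ≤ i * (i - 1ℤ)
  consecutive-product≥0 i with 0≤-or-neg (i - 1ℤ)
  ... | inj₁ p = 0≤* {i} (p ⊕ +≤+ {0} {1} z≤n by eq i) p
    where eq : ∀ i → i - 1ℤ + 1ℤ ≡ i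
          eq = solve-∀
  ... | inj₂ p = 0≤* {i = - i} {j = 1ℤ - i} (p by eq₁ i) (p ⊕ +≤+ {0} {1} z≤n by eq₂ i) by eq₃ i
    where eq₁ : ∀ i → - (i - 1ℤ) - 1ℤ ≡ - i
          eq₁ = solve-∀
          eq₂ : ∀ i → - (i - 1ℤ) - 1ℤ + 1ℤ ≡ 1ℤ - i
          eq₂ = solve-∀
          eq₃ : ∀ i → - i * (1ℤ - i) ≡ i * (i - 1ℤ)
          eq₃ = solve-∀

  -- Finite sums and indicators.

  sum-mono : ∀ {n} {f g : Fin n → ℤ} → (∀ i → f i ≤ g i) → sum f ≤ sum g
  sum-mono {zero}  p = ≤-refl
  sum-mono {suc n} p = +-mono-≤ (p zero) (sum-mono (λ i → p (suc i)))

  sum-0 : ∀ n → ∑[ i < n ] 0ℤ ≡ 0ℤ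
  sum-0 zero    = refl
  sum-0 (suc n) = trans (+-identityˡ _) (sum-0 n)

  sum-const : ∀ n c → ∑[ i < n ] c ≡ + n * c
  sum-const zero    c = sym (*-zeroˡ c)
  sum-const (suc n) c = trans (cong (λ s → c + s) (sum-const n c)) (sym ([1+m]*n≡n+m*n (+ n) c))
    where [1+m]*n≡n+m*n : ∀ m c → (1ℤ + m) * c ≡ c + m * c
          [1+m]*n≡n+m*n = solve-∀

  0≤sum : ∀ {n} {f : Fin n → ℤ} → (∀ i → 0ℤ ≤ f i) → 0ℤ ≤ sum f
  0≤sum {n} p = ≤-trans (≤-reflexive (sym (sum-0 n))) (sum-mono p)

  term≤sum : ∀ {n} {f : Fin n → ℤ} → (∀ i → 0ℤ ≤ f i) → ∀ i → f i ≤ sum f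
  term≤sum {f = f} p zero    = ≤-trans (≤-reflexive (sym (+-identityʳ _))) (+-monoʳ-≤ (f zero) (0≤sum (λ i → p (suc i))))
  term≤sum         p (suc i) = ≤-trans (term≤sum (λ j → p (suc j)) i) (≤-trans (≤-reflexive (sym (+-identityˡ _))) (+-monoˡ-≤ _ (p zero)))

  sum≤0⇒≡0 : ∀ {n} {f : Fin n → ℤ} → (∀ i → 0ℤ ≤ f i) → sum f ≤ 0ℤ → ∀ i → f i ≡ 0ℤ
  sum≤0⇒≡0 p s i = ≤-antisym (≤-trans (term≤sum p i) s) (p i)

  ⟦_⟧ : Bool → ℤ
  ⟦ true ⟧  = 1ℤ
  ⟦ false ⟧ = 0ℤ

  0≤⟦_⟧ : ∀ b → 0ℤ ≤ ⟦ b ⟧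
  0≤⟦ true ⟧  = +≤+ z≤n
  0≤⟦ false ⟧ = +≤+ z≤n

  δ : ∀ {n} → Fin n → Fin n → ℤ
  δ x y = ⟦ does (x Fin.≟ y) ⟧

  δ-refl : ∀ {n} (x : Fin n) → δ x x ≡ 1ℤ
  δ-refl zero    = refl
  δ-refl (suc x) = δ-refl x

  δ-≢ : ∀ {n} {x y : Fin n} → x ≢ y → δ x y ≡ 0ℤ
  δ-≢ {x = x} {y} x≢y with x Fin.≟ y
  ... | yes x≡y = contradiction x≡y x≢y
  ... | no _    = refl

  sum-δ : ∀ {n} (x : Fin n) (f : Fin n → ℤ) → ∑[ y < n ] (δ x y * f y) ≡ f x
  sum-δ {suc n} zero    f = trans (cong₂ _+_ (*-identityˡ (f zero)) (trans (sum-cong-≗ (λ y → *-zeroˡ (f (suc y)))) (sum-0 n))) (+-identityʳ _)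
  sum-δ {suc n} (suc x) f = trans (cong₂ _+_ (*-zeroˡ (f zero)) (sum-δ x (λ y → f (suc y)))) (+-identityˡ _)

  ∑∑ : ∀ {n} → (Fin n → Fin n → ℤ) → ℤ
  ∑∑ {n} f = ∑[ x < n ] ∑[ y < n ] f x y

  sum-* : ∀ {n} c (f : Fin n → ℤ) → ∑[ i < n ] (c * f i) ≡ c * sum f
  sum-* c f = sym (*-distribˡ-sum c f)

  ∑∑-+ : ∀ {n} (f g : Fin n → Fin n → ℤ) → ∑∑ (λ x y → f x y + g x y) ≡ ∑∑ f + ∑∑ g
  ∑∑-+ f g = trans (sum-cong-≗ (λ x → sum-+ (f x) (g x))) (sum-+ (λ x → sum (f x)) (λ x → sum (g x)))

  ∑∑-* : ∀ {n} c (f : Fin n → Fin n → ℤ) → ∑∑ (λ x y → c * f x y) ≡ c * ∑∑ f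
  ∑∑-* c f = trans (sum-cong-≗ (λ x → sum-* c (f x))) (sum-* c (λ x → sum (f x)))

  ∑∑-cong : ∀ {n} {f g : Fin n → Fin n → ℤ} → (∀ x y → f x y ≡ g x y) → ∑∑ f ≡ ∑∑ g
  ∑∑-cong p = sum-cong-≗ (λ x → sum-cong-≗ (p x))

  -- Weight systems and the linear bound on `m` and `D`.

  -- 2 * h x y and 6 * g x stand for E(x,y) and Σ_y E(x,y) of the header; the factors record divisibility.
  record PairTripleWeights (N : ℕ) (m : ℤ) : Set where
    field
      a           : Fin N → Fin N → ℤ
      a≡0∨1       : ∀ x y → a x y ≡ 0ℤ ⊎ a x y ≡ 1ℤ
      a-sym       : ∀ x y → a x y ≡ a y x
      a-irrefl    : ∀ x → a x x ≡ 0ℤ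
      β           : ℤ
      h           : Fin N → Fin N → ℤ
      g           : Fin N → ℤ
      ∑∑h         : ∑∑ (λ x y → + 2 * h x y) ≡ + 24 * β
      ∑h          : ∀ x → ∑[ y < N ] (+ 2 * h x y) ≡ + 6 * g x
      codegree≤   : ∀ x y → ∑[ z < N ] (a x y * (a x z * a y z)) ≤ + 2 * h x y
      nonadjacent : ∑∑ (λ x y → 1ℤ - δ x y - a x y) ≤ + 2 * (m - β)

    d : Fin N → ℤ
    d x = ∑[ y < N ] a x y

    D Q : ℤ
    D = sum d
    Q = ∑[ x < N ] (d x * d x)

    0≤a : ∀ x y → 0ℤ ≤ a x y
    0≤a x y with a≡0∨1 x y
    ... | inj₁ p = ≤-reflexive (sym p)
    ... | inj₂ p = ≤-trans (+≤+ z≤n) (≤-reflexive (sym p))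

    0≤1-a : ∀ x y → 0ℤ ≤ 1ℤ - a x y
    0≤1-a x y with a x y | a≡0∨1 x y
    ... | _ | inj₁ refl = +≤+ z≤n
    ... | _ | inj₂ refl = +≤+ z≤n

    0≤1-δ-a : ∀ x y → 0ℤ ≤ 1ℤ - δ x y - a x y
    0≤1-δ-a x y with x Fin.≟ y
    ... | yes refl = +≤+ z≤n by sym (cong (λ s → 0ℤ - s) (a-irrefl x))
    ... | no _     = 0≤1-a x y

    ∑-nonadjacent : ∀ x → ∑[ y < N ] (1ℤ - δ x y - a x y) ≡ + N - 1ℤ - d x
    ∑-nonadjacent x = begin
      ∑[ y < N ] (1ℤ - δ x y - a x y)                              ≡⟨ sum-cong-≗ (λ y → eq₁ (δ x y) (a x y)) ⟩
      ∑[ y < N ] (1ℤ + (- 1ℤ * (δ x y * 1ℤ) + - 1ℤ * a x y))       ≡⟨ sum-+ {N} _ _ ⟩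
      ∑[ y < N ] 1ℤ + ∑[ y < N ] (- 1ℤ * (δ x y * 1ℤ) + - 1ℤ * a x y)
        ≡⟨ cong₂ _+_ (sum-const N 1ℤ) (trans (sum-+ {N} _ _) (cong₂ _+_ (trans (sum-* {N} (- 1ℤ) _) (cong (λ s → - 1ℤ * s) (sum-δ x (λ _ → 1ℤ)))) (sum-* {N} (- 1ℤ) _))) ⟩
      + N * 1ℤ + (- 1ℤ * 1ℤ + - 1ℤ * d x)                          ≡⟨ eq₂ (+ N) (d x) ⟩
      + N - 1ℤ - d x                                               ∎
      where
      open ≡-Reasoning
      eq₁ : ∀ i j → 1ℤ - i - j ≡ 1ℤ + (- 1ℤ * (i * 1ℤ) + - 1ℤ * j)
      eq₁ = solve-∀
      eq₂ : ∀ i j → i * 1ℤ + (- 1ℤ * 1ℤ + - 1ℤ * j) ≡ i - 1ℤ - j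
      eq₂ = solve-∀

    ∑∑-nonadjacent : ∑∑ (λ x y → 1ℤ - δ x y - a x y) ≡ + N * (+ N - 1ℤ) - D
    ∑∑-nonadjacent = begin
      ∑∑ (λ x y → 1ℤ - δ x y - a x y)             ≡⟨ sum-cong-≗ (λ x → trans (∑-nonadjacent x) (eq₁ (+ N) (d x))) ⟩
      ∑[ x < N ] (+ N - 1ℤ + - 1ℤ * d x)          ≡⟨ trans (sum-+ {N} _ _) (cong₂ _+_ (sum-const N _) (sum-* (- 1ℤ) d)) ⟩
      + N * (+ N - 1ℤ) + - 1ℤ * D                 ≡⟨ eq₂ (+ N) D ⟩
      + N * (+ N - 1ℤ) - D                        ∎
      where
      open ≡-Reasoning
      eq₁ : ∀ i j → i - 1ℤ - j ≡ i - 1ℤ + - 1ℤ * j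
      eq₁ = solve-∀
      eq₂ : ∀ i j → i * (i - 1ℤ) + - 1ℤ * j ≡ i * (i - 1ℤ) - j
      eq₂ = solve-∀

    pairs-bound : 0ℤ ≤ + 2 * (m - β) - (+ N * (+ N - 1ℤ) - D)
    pairs-bound = i≤j⇒0≤j-i (subst (_≤ + 2 * (m - β)) ∑∑-nonadjacent nonadjacent)

    -- Summing `d` over first endpoints of ordered edges counts each `d x` exactly `d x` times; by
    -- symmetry of `a` the second endpoints give the same `Q`.
    ∑∑-weighted : ∀ c → ∑∑ (λ x y → a x y * (d x + d y - c)) ≡ + 2 * Q - c * D
    ∑∑-weighted c = begin
      ∑∑ (λ x y → a x y * (d x + d y - c))
        ≡⟨ ∑∑-cong (λ x y → eq₁ (a x y) (d x) (d y) c) ⟩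
      ∑∑ (λ x y → a x y * d x + (a x y * d y + - c * a x y))
        ≡⟨ trans (∑∑-+ {N} (λ x y → a x y * d x) _) (cong₂ _+_ outgoing
            (trans (∑∑-+ {N} (λ x y → a x y * d y) _) (cong₂ _+_ incoming (∑∑-* (- c) a)))) ⟩
      Q + (Q + - c * D)
        ≡⟨ eq₂ Q c D ⟩
      + 2 * Q - c * D ∎
      where
      open ≡-Reasoning
      eq₁ : ∀ i j k c → i * (j + k - c) ≡ i * j + (i * k + - c * i)
      eq₁ = solve-∀
      eq₂ : ∀ i c j → i + (i + - c * j) ≡ + 2 * i - c * j
      eq₂ = solve-∀
      outgoing : ∑∑ (λ x y → a x y * d x) ≡ Q
      outgoing = sum-cong-≗ (λ x → sym (*-distribʳ-sum (d x) (a x)))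
      incoming : ∑∑ (λ x y → a x y * d y) ≡ Q
      incoming = trans (∑-comm (λ x y → a x y * d y)) (sum-cong-≗ (λ y →
        trans (sum-cong-≗ (λ x → cong (_* d y) (a-sym x y))) (sym (*-distribʳ-sum (d y) (a y)))))

    -- Summand by summand this is (1 - a x z) (1 - a y z) ≥ 0.
    codegree≥ : ∀ x y → a x y * (d x + d y - + N) ≤ ∑[ z < N ] (a x y * (a x z * a y z))
    codegree≥ x y = ≤-trans (≤-reflexive lhs) (sum-mono pointwise)
      where
      eq₁ : ∀ i j k → i * (j + k + - 1ℤ) ≡ i * (j + (k + - 1ℤ))
      eq₁ = solve-∀
      eq₂ : ∀ i → i * - 1ℤ ≡ - i
      eq₂ = solve-∀
      eq₃ : ∀ i j k → i * ((1ℤ - j) * (1ℤ - k)) ≡ i * (j * k) - i * (j + (k + - 1ℤ))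
      eq₃ = solve-∀
      eq₄ : ∀ i j k → i + j - k ≡ i + (j + - k)
      eq₄ = solve-∀
      lhs : a x y * (d x + d y - + N) ≡ ∑[ z < N ] (a x y * (a x z + (a y z + - 1ℤ)))
      lhs = sym (trans (sum-* {N} (a x y) _) (cong (a x y *_) (trans (sum-+ {N} _ _) (trans (cong (λ s → d x + s)
        (trans (sum-+ {N} _ _) (cong (λ s → d y + s) (trans (sum-const N _) (eq₂ (+ N)))))) (sym (eq₄ (d x) (d y) (+ N)))))))
      pointwise : ∀ z → a x y * (a x z + (a y z + - 1ℤ)) ≤ a x y * (a x z * a y z)
      pointwise z = 0≤i-j⇒j≤i (0≤* (0≤a x y) (0≤* (0≤1-a x z) (0≤1-a y z)) by eq₃ (a x y) (a x z) (a y z))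

    -- The loss at one pair in the estimate of `24 β`. For `N = 6` and `N = 7` its total turns out
    -- to be too small.
    slack : Fin N → Fin N → ℤ
    slack x y = + 2 * h x y - a x y * (d x + d y - + N)

    0≤slack : ∀ x y → 0ℤ ≤ slack x y
    0≤slack x y = i≤j⇒0≤j-i (≤-trans (codegree≥ x y) (codegree≤ x y))

    ∑∑-slack : ∑∑ slack ≡ + 24 * β - (+ 2 * Q - + N * D)
    ∑∑-slack = begin
      ∑∑ slack ≡⟨ ∑∑-cong (λ x y → eq (+ 2 * h x y) (a x y * (d x + d y - + N))) ⟩
      ∑∑ (λ x y → + 2 * h x y + - 1ℤ * (a x y * (d x + d y - + N)))
        ≡⟨ trans (∑∑-+ {N} _ _) (cong₂ _+_ ∑∑h (trans (∑∑-* {N} (- 1ℤ) _) (cong (- 1ℤ *_) (∑∑-weighted (+ N))))) ⟩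
      + 24 * β + - 1ℤ * (+ 2 * Q - + N * D) ≡⟨ eq (+ 24 * β) (+ 2 * Q - + N * D) ⟨
      + 24 * β - (+ 2 * Q - + N * D) ∎
      where
      open ≡-Reasoning
      eq : ∀ i j → i - j ≡ i + - 1ℤ * j
      eq = solve-∀

    -- The loss at `x` in bounding `Q` from below by a linear function of `D`; it is zero when `d x`
    -- is `k` or `k + 1`.
    spread : ℤ → Fin N → ℤ
    spread k x = (d x - k) * (d x - k - 1ℤ)

    0≤spread : ∀ k x → 0ℤ ≤ spread k x
    0≤spread k x = consecutive-product≥0 (d x - k)

    spread≡0⇒ : ∀ k x → spread k x ≡ 0ℤ → d x ≡ k ⊎ d x ≡ k + 1ℤ
    spread≡0⇒ k x = zeros k (d x)
      where
      eq : ∀ i k → i - (k + 1ℤ) ≡ i - k - 1ℤ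
      eq = solve-∀
      zeros : ∀ k i → (i - k) * (i - k - 1ℤ) ≡ 0ℤ → i ≡ k ⊎ i ≡ k + 1ℤ
      zeros k i p with i*j≡0⇒i≡0∨j≡0 (i - k) p
      ... | inj₁ q = inj₁ (i-j≡0⇒i≡j i k q)
      ... | inj₂ q = inj₂ (i-j≡0⇒i≡j i (k + 1ℤ) (trans (eq i k) q))

    ∑-spread : ∀ k → sum (spread k) ≡ Q - (+ 2 * k + 1ℤ) * D + k * (k + 1ℤ) * + N
    ∑-spread k = begin
      sum (spread k) ≡⟨ sum-cong-≗ (λ x → eq₁ (d x) k) ⟩
      ∑[ x < N ] (d x * d x + (- (+ 2 * k + 1ℤ) * d x + k * (k + 1ℤ)))
        ≡⟨ trans (sum-+ {N} _ _) (cong (λ s → Q + s) (trans (sum-+ {N} _ _) (cong₂ _+_ (sum-* (- (+ 2 * k + 1ℤ)) d) (sum-const N (k * (k + 1ℤ)))))) ⟩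
      Q + (- (+ 2 * k + 1ℤ) * D + + N * (k * (k + 1ℤ))) ≡⟨ eq₂ Q k D (+ N) ⟩
      Q - (+ 2 * k + 1ℤ) * D + k * (k + 1ℤ) * + N ∎
      where
      open ≡-Reasoning
      eq₁ : ∀ i k → (i - k) * (i - k - 1ℤ) ≡ i * i + (- (+ 2 * k + 1ℤ) * i + k * (k + 1ℤ))
      eq₁ = solve-∀
      eq₂ : ∀ q k d n → q + (- (+ 2 * k + 1ℤ) * d + n * (k * (k + 1ℤ))) ≡ q - (+ 2 * k + 1ℤ) * d + k * (k + 1ℤ) * n
      eq₂ = solve-∀

    bound : ℤ → ℤ
    bound k = + 24 * m - + 12 * (+ N * (+ N - 1ℤ)) + (+ N + + 10 - + 4 * k) * D + + 2 * (k * (k + 1ℤ) * + N)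

    -- This is 12 times `pairs-bound` with `β` eliminated by `∑∑-slack` and `Q` by `∑-spread`. The
    -- coefficient of `D` is `12 + N - 2 (2 k + 1)`.
    slack+spread≤bound : ∀ k → 0ℤ ≤ bound k - (∑∑ slack + + 2 * sum (spread k))
    slack+spread≤bound k = 12 ⊙ pairs-bound by
      trans (eq m β (+ N) D Q k) (cong₂ (λ s t → bound k - (s + + 2 * t)) (sym ∑∑-slack) (sym (∑-spread k)))
      where
      eq : ∀ m b n d q k → + 12 * (+ 2 * (m - b) - (n * (n - 1ℤ) - d)) ≡
        + 24 * m - + 12 * (n * (n - 1ℤ)) + (n + + 10 - + 4 * k) * d + + 2 * (k * (k + 1ℤ) * n)
          - (+ 24 * b - (+ 2 * q - n * d) + + 2 * (q - (+ 2 * k + 1ℤ) * d + k * (k + 1ℤ) * n))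
      eq = solve-∀

    0≤∑∑slack : 0ℤ ≤ ∑∑ slack
    0≤∑∑slack = 0≤sum (λ x → 0≤sum (0≤slack x))

    0≤∑spread : ∀ k → 0ℤ ≤ sum (spread k)
    0≤∑spread k = 0≤sum (0≤spread k)

    0≤bound : ∀ k → 0ℤ ≤ bound k
    0≤bound k = slack+spread≤bound k ⊕ 0≤∑∑slack ⊕ 2 ⊙ 0≤∑spread k by eq (bound k) (∑∑ slack) (+ 2 * sum (spread k))
      where
      eq : ∀ b s t → b - (s + t) + s + t ≡ b
      eq = solve-∀

    0≤β : 0ℤ ≤ β
    0≤β = 0≤c*i⇒0≤i 23 (0≤sum (λ x → 0≤sum (λ y → ≤-trans (0≤sum (λ z → 0≤* (0≤a x y) (0≤* (0≤a x z) (0≤a y z)))) (codegree≤ x y))) by ∑∑h)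

  -- The value of PairTripleWeights.bound k at m = f - 1 and D = d.
  linear-bound : (n k f d : ℤ) → ℤ
  linear-bound n k f d = + 24 * (f - 1ℤ) - + 12 * (n * (n - 1ℤ)) + (n + + 10 - + 4 * k) * d + + 2 * (k * (k + 1ℤ) * n)

  -- Bounds for `N = 5` and `N ≥ 8` from the choice of `k`.

  module _ {N m} (W : PairTripleWeights N m) where
    open PairTripleWeights W

    -- If `m < f`, no `D` is possible. For `D < c` the bound at `k₁`, nondecreasing in `D`, is
    -- negative already at `c - 1`; for `D ≥ c` the bound at `k₂`, nonincreasing in `D`, is negative
    -- already at `c`.
    two-tangents : ∀ k₁ k₂ f c → 0ℤ ≤ + N + + 10 - + 4 * k₁ → 0ℤ ≤ + 4 * k₂ - (+ N + + 10) →
      linear-bound (+ N) k₁ f (c - 1ℤ) < 0ℤ → linear-bound (+ N) k₂ f c < 0ℤ → f ≤ m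
    two-tangents k₁ k₂ f c s₁ s₂ p₁ p₂ with 0≤-or-neg (m - f) | 0≤-or-neg (D - c)
    ... | inj₁ f≤m | _ = 0≤i-j⇒j≤i f≤m
    ... | inj₂ m<f | inj₁ c≤D = contradiction
      (0≤bound k₂ ⊕ 24 ⊙ m<f ⊕ 0≤* s₂ c≤D by eq (+ N) m D k₂ f c) (<⇒≱ p₂)
      where
      eq : ∀ n m d k f c → + 24 * m - + 12 * (n * (n - 1ℤ)) + (n + + 10 - + 4 * k) * d + + 2 * (k * (k + 1ℤ) * n)
        + + 24 * (- (m - f) - 1ℤ) + (+ 4 * k - (n + + 10)) * (d - c)
        ≡ + 24 * (f - 1ℤ) - + 12 * (n * (n - 1ℤ)) + (n + + 10 - + 4 * k) * c + + 2 * (k * (k + 1ℤ) * n)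
      eq = solve-∀
    ... | inj₂ m<f | inj₂ D<c = contradiction
      (0≤bound k₁ ⊕ 24 ⊙ m<f ⊕ 0≤* s₁ D<c by eq (+ N) m D k₁ f c) (<⇒≱ p₁)
      where
      eq : ∀ n m d k f c → + 24 * m - + 12 * (n * (n - 1ℤ)) + (n + + 10 - + 4 * k) * d + + 2 * (k * (k + 1ℤ) * n)
        + + 24 * (- (m - f) - 1ℤ) + (n + + 10 - + 4 * k) * (- (d - c) - 1ℤ)
        ≡ + 24 * (f - 1ℤ) - + 12 * (n * (n - 1ℤ)) + (n + + 10 - + 4 * k) * (c - 1ℤ) + + 2 * (k * (k + 1ℤ) * n)
      eq = solve-∀

    -- The threshold `2 n²` is the degree sum of the complete bipartite graph with parts of size
    -- `n`, where both estimates are attained. From there on the bound at `k = n` has slope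
    -- `10 - 2 n ≤ 0` in `D` and suffices; below it, counting pairs with `β ≥ 0` does.
    even-bound : ∀ n → + N ≡ + 2 * n → 0ℤ ≤ n - + 5 → n * n - n ≤ m
    even-bound n N≡2n 5≤n with 0≤-or-neg (D - + 2 * (n * n))
    ... | inj₁ dense = 0≤i-j⇒j≤i (0≤c*i⇒0≤i 23 (0≤bound n ⊕ 0≤* (2 ⊙ 5≤n) dense by eq (+ N) n m D N≡2n))
      where
      eq′ : ∀ n m d → + 24 * m - + 12 * (+ 2 * n * (+ 2 * n - 1ℤ)) + (+ 2 * n + + 10 - + 4 * n) * d + + 2 * (n * (n + 1ℤ) * (+ 2 * n))
        + + 2 * (n - + 5) * (d - + 2 * (n * n)) ≡ + 24 * (m - (n * n - n))
      eq′ = solve-∀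
      eq : ∀ ν n m d → ν ≡ + 2 * n → + 24 * m - + 12 * (ν * (ν - 1ℤ)) + (ν + + 10 - + 4 * n) * d + + 2 * (n * (n + 1ℤ) * ν)
        + + 2 * (n - + 5) * (d - + 2 * (n * n)) ≡ + 24 * (m - (n * n - n))
      eq _ n m d refl = eq′ n m d
    ... | inj₂ sparse = 0≤i-j⇒j≤i (0≤c*i⇒0≤i 1 (pairs-bound ⊕ 2 ⊙ 0≤β ⊕ sparse ⊕ 0≤⟦ true ⟧ by eq (+ N) n m D β N≡2n))
      where
      eq′ : ∀ n m d b → + 2 * (m - b) - (+ 2 * n * (+ 2 * n - 1ℤ) - d) + + 2 * b + (- (d - + 2 * (n * n)) - 1ℤ) + 1ℤ ≡ + 2 * (m - (n * n - n))
      eq′ = solve-∀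
      eq : ∀ ν n m d b → ν ≡ + 2 * n →
        + 2 * (m - b) - (ν * (ν - 1ℤ) - d) + + 2 * b + (- (d - + 2 * (n * n)) - 1ℤ) + 1ℤ ≡ + 2 * (m - (n * n - n))
      eq _ n m d b refl = eq′ n m d b

    -- As for even `N`, with the complete bipartite graph with parts of sizes `n` and `n + 1`. The
    -- slope at `k = n` is `11 - 2 n`, negative for `n ≥ 6`.
    odd-bound : ∀ n → + N ≡ + 2 * n + 1ℤ → 0ℤ ≤ n - + 6 → n * n ≤ m
    odd-bound n N≡2n+1 6≤n with 0≤-or-neg (D - + 2 * (n * (n + 1ℤ)))
    ... | inj₁ dense = 0≤i-j⇒j≤i (0≤c*i⇒0≤i 23 (0≤bound n ⊕ 0≤* (2 ⊙ 6≤n ⊕ 0≤⟦ true ⟧) dense by eq (+ N) n m D N≡2n+1))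
      where
      eq′ : ∀ n m d → + 24 * m - + 12 * ((+ 2 * n + 1ℤ) * (+ 2 * n + 1ℤ - 1ℤ)) + (+ 2 * n + 1ℤ + + 10 - + 4 * n) * d
        + + 2 * (n * (n + 1ℤ) * (+ 2 * n + 1ℤ)) + (+ 2 * (n - + 6) + 1ℤ) * (d - + 2 * (n * (n + 1ℤ))) ≡ + 24 * (m - n * n)
      eq′ = solve-∀
      eq : ∀ ν n m d → ν ≡ + 2 * n + 1ℤ → + 24 * m - + 12 * (ν * (ν - 1ℤ)) + (ν + + 10 - + 4 * n) * d + + 2 * (n * (n + 1ℤ) * ν)
        + (+ 2 * (n - + 6) + 1ℤ) * (d - + 2 * (n * (n + 1ℤ))) ≡ + 24 * (m - n * n)
      eq _ n m d refl = eq′ n m d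
    ... | inj₂ sparse = 0≤i-j⇒j≤i (0≤c*i⇒0≤i 1 (pairs-bound ⊕ 2 ⊙ 0≤β ⊕ sparse ⊕ 0≤⟦ true ⟧ by eq (+ N) n m D β N≡2n+1))
      where
      eq′ : ∀ n m d b → + 2 * (m - b) - ((+ 2 * n + 1ℤ) * (+ 2 * n + 1ℤ - 1ℤ) - d) + + 2 * b + (- (d - + 2 * (n * (n + 1ℤ))) - 1ℤ) + 1ℤ
        ≡ + 2 * (m - n * n)
      eq′ = solve-∀
      eq : ∀ ν n m d b → ν ≡ + 2 * n + 1ℤ →
        + 2 * (m - b) - (ν * (ν - 1ℤ) - d) + + 2 * b + (- (d - + 2 * (n * (n + 1ℤ))) - 1ℤ) + 1ℤ ≡ + 2 * (m - n * n)
      eq _ n m d b refl = eq′ n m d b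

  -- In these four cases `k₁` and `k₂` are the integers on either side of `(N + 10) / 4`, where the
  -- slope in `D` changes sign, and `c` is a point of transition between the two bounds.
  bound₅ : ∀ {m} → PairTripleWeights 5 m → + 3 ≤ m
  bound₅ W = two-tangents W (+ 3) (+ 4) (+ 3) (+ 16) (+≤+ z≤n) (+≤+ z≤n) -<+ -<+

  bound₈ : ∀ {m} → PairTripleWeights 8 m → + 12 ≤ m
  bound₈ W = two-tangents W (+ 4) (+ 5) (+ 12) (+ 40) (+≤+ z≤n) (+≤+ z≤n) -<+ -<+

  bound₉ : ∀ {m} → PairTripleWeights 9 m → + 16 ≤ m
  bound₉ W = two-tangents W (+ 4) (+ 5) (+ 16) (+ 42) (+≤+ z≤n) (+≤+ z≤n) -<+ -<+

  bound₁₁ : ∀ {m} → PairTripleWeights 11 m → + 25 ≤ m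
  bound₁₁ W = two-tangents W (+ 5) (+ 6) (+ 25) (+ 72) (+≤+ z≤n) (+≤+ z≤n) -<+ -<+

  -- The case `N = 6`.

  not-multiple : ∀ c n g → ¬ c ∣ n → + c * g ≢ + n
  not-multiple c n g c∤n eq = c∤n (subst (c ∣_) (trans (sym (abs-* (+ c) g)) (cong ∣_∣ eq)) (m∣m*n ∣ g ∣))

  -- N is not replaced by the literal 6 (or 7 below), which would make the sums unfold in conversion checks.
  module _ {N m} (W : PairTripleWeights N m) (N≡6 : + N ≡ + 6) (v : Fin N) (m<6 : 0ℤ ≤ - (m - + 6) - 1ℤ) where
    open PairTripleWeights W

    private
      -- The bound at k = 4 is attained, so every inequality used in it is an equality.
      tight : 0ℤ ≤ - (∑∑ slack + + 2 * sum (spread (+ 4)))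
      tight = slack+spread≤bound (+ 4) ⊕ 24 ⊙ m<6 by eq (+ N) m D (∑∑ slack + + 2 * sum (spread (+ 4))) N≡6
        where
        eq′ : ∀ m d x → + 24 * m - + 12 * (+ 6 * (+ 6 - 1ℤ)) + (+ 6 + + 10 - + 4 * + 4) * d + + 2 * (+ 4 * (+ 4 + 1ℤ) * + 6)
          - x + + 24 * (- (m - + 6) - 1ℤ) ≡ - x
        eq′ = solve-∀
        eq : ∀ ν m d x → ν ≡ + 6 → + 24 * m - + 12 * (ν * (ν - 1ℤ)) + (ν + + 10 - + 4 * + 4) * d + + 2 * (+ 4 * (+ 4 + 1ℤ) * ν)
          - x + + 24 * (- (m - + 6) - 1ℤ) ≡ - x
        eq _ m d x refl = eq′ m d x

      slack≡0 : ∀ x y → slack x y ≡ 0ℤ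
      slack≡0 x = sum≤0⇒≡0 (0≤slack x) (≤-reflexive (sum≤0⇒≡0 (λ x → 0≤sum (0≤slack x))
        (0≤i-j⇒j≤i (tight ⊕ 2 ⊙ 0≤∑spread (+ 4) by eq (∑∑ slack) (sum (spread (+ 4))))) x))
        where
        eq : ∀ s t → - (s + + 2 * t) + + 2 * t ≡ 0ℤ - s
        eq = solve-∀

      spread≡0 : ∀ x → spread (+ 4) x ≡ 0ℤ
      spread≡0 = sum≤0⇒≡0 (0≤spread (+ 4)) (0≤i-j⇒j≤i (0≤c*i⇒0≤i 1 (tight ⊕ 0≤∑∑slack by eq (∑∑ slack) (sum (spread (+ 4))))))
        where
        eq : ∀ s t → - (s + + 2 * t) + s ≡ + 2 * (0ℤ - t)
        eq = solve-∀

      d≡4∨5 : ∀ x → d x ≡ + 4 ⊎ d x ≡ + 5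
      d≡4∨5 x = spread≡0⇒ (+ 4) x (spread≡0 x)

      2h≡ : ∀ x y → + 2 * h x y ≡ a x y * (d x + d y - + 6)
      2h≡ x y = trans (i-j≡0⇒i≡j (+ 2 * h x y) (a x y * (d x + d y - + N)) (slack≡0 x y)) (cong (λ ν → a x y * (d x + d y - ν)) N≡6)

      -- With zero slack, equal degrees determine the sum of `2 * h x y` over `y`. For `k = 4` and
      -- `k = 5` it is 8 and 20, neither a multiple of 6.
      regular : ∀ k x → (∀ y → d y ≡ k) → + 6 * g x ≡ (k + k - + 6) * k
      regular k x p = begin
        + 6 * g x                              ≡⟨ ∑h x ⟨
        ∑[ y < N ] (+ 2 * h x y)
          ≡⟨ sum-cong-≗ (λ y → trans (2h≡ x y) (trans (cong₂ (λ s t → a x y * (s + t - + 6)) (p x) (p y)) (*-comm (a x y) (k + k - + 6)))) ⟩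
        ∑[ y < N ] ((k + k - + 6) * a x y)     ≡⟨ sum-* (k + k - + 6) (a x) ⟩
        (k + k - + 6) * d x                    ≡⟨ cong ((k + k - + 6) *_) (p x) ⟩
        (k + k - + 6) * k                      ∎
        where open ≡-Reasoning

      -- Degree 5 is the largest possible on six points, so the nonnegative terms of `∑-nonadjacent`
      -- add up to 0.
      full : ∀ {x y} → d x ≡ + 5 → x ≢ y → a x y ≡ 1ℤ
      full {x} {y} dx≡5 x≢y = one (δ-≢ x≢y) (sum≤0⇒≡0 (0≤1-δ-a x) (≤-reflexive (trans (∑-nonadjacent x) (6-1-5 N≡6 dx≡5))) y)
        where
        6-1-5 : ∀ {i j} → i ≡ + 6 → j ≡ + 5 → i - 1ℤ - j ≡ 0ℤ
        6-1-5 refl refl = refl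
        one : ∀ {i j} → i ≡ 0ℤ → 1ℤ - i - j ≡ 0ℤ → j ≡ 1ℤ
        one {j = j} refl p = sym (i-j≡0⇒i≡j 1ℤ j p)

      -- A vertex of degree 5 is adjacent to all others; a neighbour of degree 4 would give
      -- `2 * h x y = 5 + 4 - 6`, which is odd.
      all≡5 : ∀ {x} → d x ≡ + 5 → ∀ y → d y ≡ + 5
      all≡5 {x} dx≡5 y = cases (x Fin.≟ y) (d≡4∨5 y)
        where
        1*[5+4-6] : ∀ {i j k} → i ≡ 1ℤ → j ≡ + 5 → k ≡ + 4 → i * (j + k - + 6) ≡ + 3
        1*[5+4-6] refl refl refl = refl
        cases : Dec (x ≡ y) → d y ≡ + 4 ⊎ d y ≡ + 5 → d y ≡ + 5
        cases _          (inj₂ dy≡5) = dy≡5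
        cases (yes refl) (inj₁ _)    = dx≡5
        cases (no x≢y)   (inj₁ dy≡4) = ⊥-elim (not-multiple 2 3 (h x y) (toWitnessFalse {a? = 2 ∣? 3} _)
          (trans (2h≡ x y) (1*[5+4-6] (full dx≡5 x≢y) dx≡5 dy≡4)))

    no-weights₆ : ⊥
    no-weights₆ = cases (Fin.any? (λ x → d x ≟ + 5))
      where
      d≡4 : ¬ (∃ λ x → d x ≡ + 5) → ∀ y → d y ≡ + 4
      d≡4 ¬5 y = [ (λ p → p) , (λ p → contradiction (y , p) ¬5) ]′ (d≡4∨5 y)
      cases : Dec (∃ λ x → d x ≡ + 5) → ⊥
      cases (yes (x , dx≡5)) = not-multiple 6 20 (g x) (toWitnessFalse {a? = 6 ∣? 20} _) (regular (+ 5) x (all≡5 dx≡5))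
      cases (no ¬5)          = not-multiple 6 8 (g v) (toWitnessFalse {a? = 6 ∣? 8} _) (regular (+ 4) v (d≡4 ¬5))

  bound₆ : ∀ {m} → PairTripleWeights 6 m → + 6 ≤ m
  bound₆ {m} W with 0≤-or-neg (m - + 6)
  ... | inj₁ 6≤m = 0≤i-j⇒j≤i 6≤m
  ... | inj₂ m<6 = ⊥-elim (no-weights₆ W refl zero m<6)

  -- The case `N = 7`.

  module _ {N m} (W : PairTripleWeights N m) (N≡7 : + N ≡ + 7) (m<9 : 0ℤ ≤ - (m - + 9) - 1ℤ) where
    open PairTripleWeights W

    private
      -- `T` is the number of triangles as ordered triples.
      S T : ℤ
      S = ∑∑ slack
      T = ∑∑ (λ x y → ∑[ z < N ] (a x y * (a x z * a y z)))

      S≤D-32 : 0ℤ ≤ D - + 32 - S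
      S≤D-32 = slack+spread≤bound (+ 4) ⊕ 24 ⊙ m<9 ⊕ 2 ⊙ 0≤∑spread (+ 4) by eq (+ N) m D S (sum (spread (+ 4))) N≡7
        where
        eq′ : ∀ m d s t → + 24 * m - + 12 * (+ 7 * (+ 7 - 1ℤ)) + (+ 7 + + 10 - + 4 * + 4) * d + + 2 * (+ 4 * (+ 4 + 1ℤ) * + 7)
          - (s + + 2 * t) + + 24 * (- (m - + 9) - 1ℤ) + + 2 * t ≡ d - + 32 - s
        eq′ = solve-∀
        eq : ∀ ν m d s t → ν ≡ + 7 → + 24 * m - + 12 * (ν * (ν - 1ℤ)) + (ν + + 10 - + 4 * + 4) * d + + 2 * (+ 4 * (+ 4 + 1ℤ) * ν)
          - (s + + 2 * t) + + 24 * (- (m - + 9) - 1ℤ) + + 2 * t ≡ d - + 32 - s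
        eq _ m d s t refl = eq′ m d s t

      S≤108-3D : 0ℤ ≤ + 108 - + 3 * D - S
      S≤108-3D = slack+spread≤bound (+ 5) ⊕ 24 ⊙ m<9 ⊕ 2 ⊙ 0≤∑spread (+ 5) by eq (+ N) m D S (sum (spread (+ 5))) N≡7
        where
        eq′ : ∀ m d s t → + 24 * m - + 12 * (+ 7 * (+ 7 - 1ℤ)) + (+ 7 + + 10 - + 4 * + 5) * d + + 2 * (+ 5 * (+ 5 + 1ℤ) * + 7)
          - (s + + 2 * t) + + 24 * (- (m - + 9) - 1ℤ) + + 2 * t ≡ + 108 - + 3 * d - s
        eq′ = solve-∀
        eq : ∀ ν m d s t → ν ≡ + 7 → + 24 * m - + 12 * (ν * (ν - 1ℤ)) + (ν + + 10 - + 4 * + 5) * d + + 2 * (+ 5 * (+ 5 + 1ℤ) * ν)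
          - (s + + 2 * t) + + 24 * (- (m - + 9) - 1ℤ) + + 2 * t ≡ + 108 - + 3 * d - s
        eq _ m d s t refl = eq′ m d s t

      -- Three times the bound at `k = 4` plus the bound at `k = 5` cancels `D`.
      S≤3 : 0ℤ ≤ + 3 - S
      S≤3 = 0≤c*i⇒0≤i 3 (3 ⊙ S≤D-32 ⊕ S≤108-3D by eq D S)
        where
        eq : ∀ d s → + 3 * (d - + 32 - s) + (+ 108 - + 3 * d - s) ≡ + 4 * (+ 3 - s)
        eq = solve-∀

      2Q-ND≤T : + 2 * Q - + N * D ≤ T
      2Q-ND≤T = ≤-trans (≤-reflexive (sym (∑∑-weighted (+ N)))) (sum-mono (λ x → sum-mono (codegree≥ x)))

      -- The three slacks of a triangle have odd sum 2(...) + 21, so they are not all 0.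
      triangle-slack : ∀ x y z → a x y * (a x z * a y z) ≤ slack x y + (slack x z + slack y z)
      triangle-slack x y z = lemma N≡7 (a≡0∨1 x y) (a≡0∨1 x z) (a≡0∨1 y z) (0≤slack x y ⊕ (0≤slack x z ⊕ 0≤slack y z))
        where
        eq₀ : ∀ i j → i * (0ℤ * j) ≡ 0ℤ
        eq₀ = solve-∀
        eq₁ : ∀ i j → i * (j * 0ℤ) ≡ 0ℤ
        eq₁ = solve-∀
        eq₂ : ∀ h₁ h₂ h₃ d₁ d₂ d₃ → + 2 * h₁ - 1ℤ * (d₁ + d₂ - + 7) + (+ 2 * h₂ - 1ℤ * (d₁ + d₃ - + 7) + (+ 2 * h₃ - 1ℤ * (d₂ + d₃ - + 7)))
          ≡ + 2 * (h₁ + h₂ + h₃ - d₁ - d₂ - d₃) + + 21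
        eq₂ = solve-∀
        eq₃ : ∀ k → + 2 * (k + + 10) ≡ + 2 * k + + 21 - 1ℤ
        eq₃ = solve-∀
        eq₄ : ∀ k → + 2 * (- (k + + 10) - 1ℤ) + (+ 2 * k + + 21) ≡ -[1+ 0 ]
        eq₄ = solve-∀
        odd≥1 : ∀ k → 0ℤ ≤ + 2 * k + + 21 → 1ℤ ≤ + 2 * k + + 21
        odd≥1 k p with 0≤-or-neg (k + + 10)
        ... | inj₁ q = 0≤i-j⇒j≤i (2 ⊙ q by eq₃ k)
        ... | inj₂ q = contradiction (2 ⊙ q ⊕ p by eq₄ k) 0≰-[1+ 0 ]
        lemma : ∀ {ν i j k} → ν ≡ + 7 → i ≡ 0ℤ ⊎ i ≡ 1ℤ → j ≡ 0ℤ ⊎ j ≡ 1ℤ → k ≡ 0ℤ ⊎ k ≡ 1ℤ →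
          0ℤ ≤ + 2 * h x y - i * (d x + d y - ν) + (+ 2 * h x z - j * (d x + d z - ν) + (+ 2 * h y z - k * (d y + d z - ν))) →
          i * (j * k) ≤ + 2 * h x y - i * (d x + d y - ν) + (+ 2 * h x z - j * (d x + d z - ν) + (+ 2 * h y z - k * (d y + d z - ν)))
        lemma _ (inj₁ refl) _ _ p = p
        lemma {i = i} {k = k} _ (inj₂ _) (inj₁ refl) _ p = ≤-trans (≤-reflexive (eq₀ i k)) p
        lemma {i = i} {j} _ (inj₂ _) (inj₂ _) (inj₁ refl) p = ≤-trans (≤-reflexive (eq₁ i j)) p
        lemma refl (inj₂ refl) (inj₂ refl) (inj₂ refl) p =
          ≤-trans (odd≥1 (h x y + h x z + h y z - d x - d y - d z) (p by eq₅)) (≤-reflexive (sym eq₅))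
          where eq₅ = eq₂ (h x y) (h x z) (h y z) (d x) (d y) (d z)

      -- Summing `triangle-slack` over all ordered triples, each of its three terms leaves one
      -- coordinate free and contributes `N * S`.
      T≤3NS : T ≤ + 3 * (+ N * S)
      T≤3NS = ≤-trans (sum-mono (λ x → sum-mono (λ y → sum-mono (triangle-slack x y)))) (≤-reflexive total)
        where
        open ≡-Reasoning
        eq : ∀ s → s + (s + s) ≡ + 3 * s
        eq = solve-∀
        total : ∑∑ (λ x y → ∑[ z < N ] (slack x y + (slack x z + slack y z))) ≡ + 3 * (+ N * S)
        total = begin
          ∑∑ (λ x y → ∑[ z < N ] (slack x y + (slack x z + slack y z)))
            ≡⟨ ∑∑-cong (λ x y → trans (sum-+ {N} (λ _ → slack x y) _) (cong₂ _+_ (sum-const N (slack x y)) (sum-+ (slack x) (slack y)))) ⟩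
          ∑∑ (λ x y → + N * slack x y + (sum (slack x) + sum (slack y)))
            ≡⟨ trans (∑∑-+ (λ x y → + N * slack x y) _) (cong₂ _+_ (∑∑-* (+ N) slack) (∑∑-+ (λ x y → sum (slack x)) (λ x y → sum (slack y)))) ⟩
          + N * S + (∑[ x < N ] ∑[ y < N ] sum (slack x) + ∑[ x < N ] S)
            ≡⟨ cong (λ s → + N * S + s) (cong₂ _+_ (trans (sum-cong-≗ (λ x → sum-const N (sum (slack x)))) (sum-* (+ N) (λ x → sum (slack x)))) (sum-const N S)) ⟩
          + N * S + (+ N * S + + N * S) ≡⟨ eq (+ N * S) ⟩
          + 3 * (+ N * S) ∎

    -- The degrees force many triangles: `Q ≥ 9 D - 140` and `D ≥ 32 + S` give
    -- `T ≥ 11 D - 280 ≥ 72 + 11 S`. But `T ≤ 21 S`, so `72 ≤ 10 S`, against `S ≤ 3`. The deficit is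
    -- `72 - 30 = 42`.
    no-weights₇ : ⊥
    no-weights₇ = contradiction
      (i≤j⇒0≤j-i T≤3NS ⊕ i≤j⇒0≤j-i 2Q-ND≤T ⊕ (2 ⊙ (0≤∑spread (+ 4) by ∑-spread (+ 4))) ⊕ 11 ⊙ S≤D-32 ⊕ 10 ⊙ S≤3 by eq (+ N) S T Q D N≡7)
      0≰-[1+ 41 ]
      where
      eq′ : ∀ s t q d → + 3 * (+ 7 * s) - t + (t - (+ 2 * q - + 7 * d)) + + 2 * (q - (+ 2 * + 4 + 1ℤ) * d + + 4 * (+ 4 + 1ℤ) * + 7)
        + + 11 * (d - + 32 - s) + + 10 * (+ 3 - s) ≡ -[1+ 41 ]
      eq′ = solve-∀
      eq : ∀ ν s t q d → ν ≡ + 7 → + 3 * (ν * s) - t + (t - (+ 2 * q - ν * d)) + + 2 * (q - (+ 2 * + 4 + 1ℤ) * d + + 4 * (+ 4 + 1ℤ) * ν)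
        + + 11 * (d - + 32 - s) + + 10 * (+ 3 - s) ≡ -[1+ 41 ]
      eq _ s t q d refl = eq′ s t q d

  bound₇ : ∀ {m} → PairTripleWeights 7 m → + 9 ≤ m
  bound₇ {m} W with 0≤-or-neg (m - + 9)
  ... | inj₁ 9≤m = 0≤i-j⇒j≤i 9≤m
  ... | inj₂ m<9 = ⊥-elim (no-weights₇ W refl m<9)

  -- The bound for all `N > 5`, by parity of `N`.

  weights-bound-odd : ∀ k {m} → 5 ℕ.< suc (2 ℕ.* k) → PairTripleWeights (suc (2 ℕ.* k)) (+ m) → k ℕ.* k ℕ.≤ m
  weights-bound-odd 0 (s≤s ()) W
  weights-bound-odd 1 (s≤s (s≤s (s≤s ()))) W
  weights-bound-odd 2 (s≤s (s≤s (s≤s (s≤s (s≤s ()))))) W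
  weights-bound-odd 3 _ W = drop‿+≤+ (bound₇ W)
  weights-bound-odd 4 _ W = drop‿+≤+ (bound₉ W)
  weights-bound-odd 5 _ W = drop‿+≤+ (bound₁₁ W)
  weights-bound-odd k@(suc (suc (suc (suc (suc (suc j)))))) {m} _ W = drop‿+≤+ (subst (_≤ + m) (sym (pos-* k k))
    (odd-bound W (+ k) (trans (cong +_ (ℕ.+-comm 1 (2 ℕ.* k))) (cong (_+ 1ℤ) (pos-* 2 k))) (i≤j⇒0≤j-i {+ 6} (+≤+ (ℕ.m≤m+n 6 j)))))

  weights-bound-even : ∀ k {m} → 5 ℕ.< suc (suc (2 ℕ.* k)) → PairTripleWeights (suc (suc (2 ℕ.* k))) (+ m) → k ℕ.* k ℕ.+ k ℕ.≤ m
  weights-bound-even 0 (s≤s (s≤s ())) W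
  weights-bound-even 1 (s≤s (s≤s (s≤s (s≤s ())))) W
  weights-bound-even 2 _ W = drop‿+≤+ (bound₆ W)
  weights-bound-even 3 _ W = drop‿+≤+ (bound₈ W)
  -- Now `N = 2 (k + 1)`, so `even-bound` is applied at `k + 1`.
  weights-bound-even k@(suc (suc (suc (suc j)))) {m} _ W = drop‿+≤+ (subst (_≤ + m) square
    (even-bound W (+ suc k) (trans (cong +_ (sym (ℕ.*-suc 2 k))) (pos-* 2 (suc k))) (i≤j⇒0≤j-i {+ 5} (+≤+ (ℕ.m≤m+n 5 j)))))
    where
    eq : ∀ i → (1ℤ + i) * (1ℤ + i) - (1ℤ + i) ≡ i * i + i
    eq = solve-∀
    square : + suc k * + suc k - + suc k ≡ + (k ℕ.* k ℕ.+ k)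
    square = trans (eq (+ k)) (cong (_+ + k) (sym (pos-* k k)))

  -- Weights obtained from shapes, and from a clique cover.

  0≤δ : ∀ {n} (x y : Fin n) → 0ℤ ≤ δ x y
  0≤δ x y = 0≤⟦ _ ⟧

  0≤1-δ : ∀ {n} (x y : Fin n) → 0ℤ ≤ 1ℤ - δ x y
  0≤1-δ x y with x Fin.≟ y
  ... | yes _ = +≤+ z≤n
  ... | no _  = +≤+ z≤n

  ∑∑-δδ : ∀ {n} (p q : Fin n) → ∑∑ (λ x y → δ p x * δ q y) ≡ 1ℤ
  ∑∑-δδ p q = trans (sum-cong-≗ (λ x → trans (sum-* (δ p x) (δ q)) (cong (δ p x *_) (∑-δ q)))) (sum-δ p (λ _ → 1ℤ))
    where
    ∑-δ : ∀ {n} (q : Fin n) → sum (δ q) ≡ 1ℤ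
    ∑-δ q = trans (sum-cong-≗ (λ y → sym (*-identityʳ (δ q y)))) (sum-δ q (λ _ → 1ℤ))

  distinct : (p q r : Fin 4) → ℤ
  distinct p q r = (1ℤ - δ p q) * ((1ℤ - δ p r) * (1ℤ - δ q r))

  module Quad {n} (V : Fin 4 → Fin n) where

    -- These three count tuples of different indices in `Fin 4` with prescribed images. Requiring
    -- different indices, not different images, makes the totals independent of `V`.
    corners : Fin n → ℤ
    corners x = ∑[ p < 4 ] δ (V p) x

    edges : Fin n → Fin n → ℤ
    edges x y = ∑[ p < 4 ] ∑[ q < 4 ] (δ (V p) x * (δ (V q) y * (1ℤ - δ p q)))

    faces : Fin n → Fin n → Fin n → ℤ
    faces x y z = ∑[ p < 4 ] ∑[ q < 4 ] ∑[ r < 4 ] (δ (V p) x * (δ (V q) y * (δ (V r) z * distinct p q r)))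

    ∑-corners : sum corners ≡ + 4
    ∑-corners = trans (∑-comm (λ x p → δ (V p) x)) (sum-cong-≗ {4} {λ p → ∑[ x < n ] δ (V p) x} {λ _ → 1ℤ}
      (λ p → trans (sum-cong-≗ (λ x → sym (*-identityʳ (δ (V p) x)))) (sum-δ (V p) (λ _ → 1ℤ))))

    ∑-edges : ∀ x → ∑[ y < n ] edges x y ≡ + 3 * corners x
    ∑-edges x = begin
      ∑[ y < n ] edges x y
        ≡⟨ ∑-comm (λ y p → ∑[ q < 4 ] (δ (V p) x * (δ (V q) y * (1ℤ - δ p q)))) ⟩
      ∑[ p < 4 ] ∑[ y < n ] ∑[ q < 4 ] (δ (V p) x * (δ (V q) y * (1ℤ - δ p q)))
        ≡⟨ sum-cong-≗ (λ p → ∑-comm (λ y q → δ (V p) x * (δ (V q) y * (1ℤ - δ p q)))) ⟩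
      ∑[ p < 4 ] ∑[ q < 4 ] ∑[ y < n ] (δ (V p) x * (δ (V q) y * (1ℤ - δ p q)))
        ≡⟨ sum-cong-≗ (λ p → sum-cong-≗ (λ q → trans (sum-* {n} (δ (V p) x) _) (cong (δ (V p) x *_) (sum-δ (V q) (λ _ → 1ℤ - δ p q))))) ⟩
      ∑[ p < 4 ] ∑[ q < 4 ] (δ (V p) x * (1ℤ - δ p q))
        ≡⟨ sum-cong-≗ (λ p → trans (sum-* (δ (V p) x) (λ q → 1ℤ - δ p q)) (trans (cong (δ (V p) x *_) (three p)) (*-comm (δ (V p) x) (+ 3)))) ⟩
      ∑[ p < 4 ] (+ 3 * δ (V p) x)
        ≡⟨ sum-* (+ 3) (λ p → δ (V p) x) ⟩
      + 3 * corners x ∎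
      where
      open ≡-Reasoning
      three : ∀ (p : Fin 4) → ∑[ q < 4 ] (1ℤ - δ p q) ≡ + 3
      three = from-yes (Fin.all? (λ (p : Fin 4) → ∑[ q < 4 ] (1ℤ - δ p q) ≟ + 3))

    -- Two different indices leave two others. This 2 and the 3 of `∑-edges` are the source of the
    -- divisibility by 2 and 6.
    ∑-faces : ∀ x y → ∑[ z < n ] faces x y z ≡ + 2 * edges x y
    ∑-faces x y = begin
      ∑[ z < n ] faces x y z
        ≡⟨ ∑-comm (λ z p → ∑[ q < 4 ] ∑[ r < 4 ] (δ (V p) x * (δ (V q) y * (δ (V r) z * distinct p q r)))) ⟩
      ∑[ p < 4 ] ∑[ z < n ] ∑[ q < 4 ] ∑[ r < 4 ] (δ (V p) x * (δ (V q) y * (δ (V r) z * distinct p q r)))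
        ≡⟨ sum-cong-≗ (λ p → ∑-comm (λ z q → ∑[ r < 4 ] (δ (V p) x * (δ (V q) y * (δ (V r) z * distinct p q r))))) ⟩
      ∑[ p < 4 ] ∑[ q < 4 ] ∑[ z < n ] ∑[ r < 4 ] (δ (V p) x * (δ (V q) y * (δ (V r) z * distinct p q r)))
        ≡⟨ ∑∑-cong (λ p q → ∑-comm (λ z r → δ (V p) x * (δ (V q) y * (δ (V r) z * distinct p q r)))) ⟩
      ∑[ p < 4 ] ∑[ q < 4 ] ∑[ r < 4 ] ∑[ z < n ] (δ (V p) x * (δ (V q) y * (δ (V r) z * distinct p q r)))
        ≡⟨ ∑∑-cong (λ p q → sum-cong-≗ (λ r → trans (sum-* {n} (δ (V p) x) _) (cong (δ (V p) x *_)
             (trans (sum-* {n} (δ (V q) y) _) (cong (δ (V q) y *_) (sum-δ (V r) (λ _ → distinct p q r))))))) ⟩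
      ∑[ p < 4 ] ∑[ q < 4 ] ∑[ r < 4 ] (δ (V p) x * (δ (V q) y * distinct p q r))
        ≡⟨ ∑∑-cong (λ p q → trans (sum-* (δ (V p) x) (λ r → δ (V q) y * distinct p q r)) (trans (cong (δ (V p) x *_)
             (trans (sum-* (δ (V q) y) (distinct p q)) (cong (δ (V q) y *_) (two p q)))) (pull (δ (V p) x) (δ (V q) y) (1ℤ - δ p q)))) ⟩
      ∑[ p < 4 ] ∑[ q < 4 ] (+ 2 * (δ (V p) x * (δ (V q) y * (1ℤ - δ p q))))
        ≡⟨ ∑∑-* (+ 2) (λ p q → δ (V p) x * (δ (V q) y * (1ℤ - δ p q))) ⟩
      + 2 * edges x y ∎
      where
      open ≡-Reasoning
      pull : ∀ i j k → i * (j * (+ 2 * k)) ≡ + 2 * (i * (j * k))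
      pull = solve-∀
      two : ∀ (p q : Fin 4) → ∑[ r < 4 ] distinct p q r ≡ + 2 * (1ℤ - δ p q)
      two = from-yes (Fin.all? (λ (p : Fin 4) → Fin.all? (λ (q : Fin 4) → ∑[ r < 4 ] distinct p q r ≟ + 2 * (1ℤ - δ p q))))

    0≤faces-term : ∀ x y z p q r → 0ℤ ≤ δ (V p) x * (δ (V q) y * (δ (V r) z * distinct p q r))
    0≤faces-term x y z p q r = 0≤* (0≤δ (V p) x) (0≤* (0≤δ (V q) y) (0≤* (0≤δ (V r) z) (0≤* (0≤1-δ p q) (0≤* (0≤1-δ p r) (0≤1-δ q r)))))

    0≤faces : ∀ x y z → 0ℤ ≤ faces x y z
    0≤faces x y z = 0≤sum (λ p → 0≤sum (λ q → 0≤sum (0≤faces-term x y z p q)))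

    -- The given preimages contribute a term equal to 1; they are different indices because their
    -- images differ.
    1≤faces : ∀ {x y z} → x ≢ y → x ≢ z → y ≢ z → (∃ λ p → V p ≡ x) → (∃ λ q → V q ≡ y) → (∃ λ r → V r ≡ z) → 1ℤ ≤ faces x y z
    1≤faces {x} {y} {z} x≢y x≢z y≢z (p , refl) (q , refl) (r , refl) =
      ≤-trans (≤-reflexive (sym one)) (≤-trans (term≤sum (0≤faces-term x y z p q) r)
        (≤-trans (term≤sum (λ q → 0≤sum (0≤faces-term x y z p q)) q) (term≤sum (λ p → 0≤sum (λ q → 0≤sum (0≤faces-term x y z p q))) p)))
      where
      one : δ (V p) (V p) * (δ (V q) (V q) * (δ (V r) (V r) * distinct p q r)) ≡ 1ℤ
      one rewrite δ-refl (V p) | δ-refl (V q) | δ-refl (V r)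
        | δ-≢ {x = p} {q} (x≢y ∘ cong V) | δ-≢ {x = p} {r} (x≢z ∘ cong V) | δ-≢ {x = q} {r} (y≢z ∘ cong V) = refl

  module _ {n} {M : Subset n → Set} where

    Marks : Shape M → Fin n → Fin n → Set
    Marks (common-pair p q _ _) x y = (p ≡ x × q ≡ y) ⊎ (p ≡ y × q ≡ x)
    Marks (within-quad _ _)     x y = ⊥

    marks? : ∀ s x y → Dec (Marks s x y)
    marks? (common-pair p q _ _) x y = (p Fin.≟ x) ×-dec (q Fin.≟ y) ⊎-dec (p Fin.≟ y) ×-dec (q Fin.≟ x)
    marks? (within-quad _ _)     x y = no λ ()

    Marks-sym : ∀ s {x y} → Marks s x y → Marks s y x
    Marks-sym (common-pair p q _ _) (inj₁ e) = inj₂ e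
    Marks-sym (common-pair p q _ _) (inj₂ e) = inj₁ e

    quads pairs : Shape M → ℤ
    quads (common-pair _ _ _ _) = 0ℤ
    quads (within-quad _ _)     = 1ℤ
    pairs (common-pair _ _ _ _) = 1ℤ
    pairs (within-quad _ _)     = 0ℤ

    quads+pairs : ∀ s → quads s + pairs s ≡ 1ℤ
    quads+pairs (common-pair _ _ _ _) = refl
    quads+pairs (within-quad _ _)     = refl

    -- A numerical majorant of `Marks`, written as a sum of products so that its total follows from
    -- `∑∑-δδ`.
    marks : Shape M → Fin n → Fin n → ℤ
    marks (common-pair p q _ _) x y = δ p x * δ q y + δ p y * δ q x
    marks (within-quad _ _)     x y = 0ℤ

    ∑∑-marks : ∀ s → ∑∑ (marks s) ≡ + 2 * pairs s
    ∑∑-marks (common-pair p q _ _) = trans (∑∑-+ (λ x y → δ p x * δ q y) (λ x y → δ p y * δ q x))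
      (cong₂ _+_ (∑∑-δδ p q) (trans (∑-comm (λ x y → δ p y * δ q x)) (∑∑-δδ p q)))
    ∑∑-marks (within-quad _ _) = trans (sum-cong-≗ {n} (λ _ → sum-0 n)) (sum-0 n)

    0≤marks : ∀ s x y → 0ℤ ≤ marks s x y
    0≤marks (common-pair p q _ _) x y = 0≤* (0≤δ p x) (0≤δ q y) ⊕ 0≤* (0≤δ p y) (0≤δ q x)
    0≤marks (within-quad _ _)     x y = +≤+ z≤n

    1≤marks : ∀ s {x y} → Marks s x y → 1ℤ ≤ marks s x y
    1≤marks (common-pair p q _ _) {x} {y} (inj₁ (refl , refl)) rewrite δ-refl p | δ-refl q =
      +-monoʳ-≤ 1ℤ (0≤* (0≤δ p q) (0≤δ q p))
    1≤marks (common-pair p q _ _) {x} {y} (inj₂ (refl , refl)) rewrite δ-refl p | δ-refl q =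
      +-monoˡ-≤ 1ℤ (0≤* (0≤δ p q) (0≤δ q p))

    corners : Shape M → Fin n → ℤ
    corners (common-pair _ _ _ _) x = 0ℤ
    corners (within-quad V _)     x = Quad.corners V x

    edges : Shape M → Fin n → Fin n → ℤ
    edges (common-pair _ _ _ _) x y = 0ℤ
    edges (within-quad V _)     x y = Quad.edges V x y

    faces : Shape M → Fin n → Fin n → Fin n → ℤ
    faces (common-pair _ _ _ _) x y z = 0ℤ
    faces (within-quad V _)     x y z = Quad.faces V x y z

    ∑-corners : ∀ s → sum (corners s) ≡ + 4 * quads s
    ∑-corners (common-pair _ _ _ _) = sum-0 n
    ∑-corners (within-quad V _)     = Quad.∑-corners V

    ∑-edges : ∀ s x → sum (edges s x) ≡ + 3 * corners s x
    ∑-edges (common-pair _ _ _ _) x = sum-0 n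
    ∑-edges (within-quad V _)     x = Quad.∑-edges V x

    ∑-faces : ∀ s x y → sum (faces s x y) ≡ + 2 * edges s x y
    ∑-faces (common-pair _ _ _ _) x y = sum-0 n
    ∑-faces (within-quad V _)     x y = Quad.∑-faces V x y

    0≤faces : ∀ s x y z → 0ℤ ≤ faces s x y z
    0≤faces (common-pair _ _ _ _) x y z = +≤+ z≤n
    0≤faces (within-quad V _)     x y z = Quad.0≤faces V x y z

    -- A common pair of a family containing `xyz` would be two of these three points, hence one of
    -- the pairs assumed unmarked. So the shape is a quad.
    1≤faces : ∀ s {x y z} → x ≢ y → x ≢ z → y ≢ z → ¬ Marks s x y → ¬ Marks s x z → ¬ Marks s y z → M (triple x y z) → 1ℤ ≤ faces s x y z
    1≤faces (within-quad V f) x≢y x≢z y≢z _ _ _ m = Quad.1≤faces V x≢y x≢z y≢z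
      (f m (∈triple⁺ (inj₁ refl))) (f m (∈triple⁺ (inj₂ (inj₁ refl)))) (f m (∈triple⁺ (inj₂ (inj₂ refl))))
    1≤faces (common-pair p q p≢q f) {x} {y} {z} x≢y x≢z y≢z ¬xy ¬xz ¬yz m = ⊥-elim (cases (∈triple⁻ (proj₁ (f m))) (∈triple⁻ (proj₂ (f m))))
      where
      cases : p ≡ x ⊎ p ≡ y ⊎ p ≡ z → q ≡ x ⊎ q ≡ y ⊎ q ≡ z → ⊥
      cases (inj₁ a)        (inj₁ b)        = p≢q (trans a (sym b))
      cases (inj₁ a)        (inj₂ (inj₁ b)) = ¬xy (inj₁ (a , b))
      cases (inj₁ a)        (inj₂ (inj₂ b)) = ¬xz (inj₁ (a , b))
      cases (inj₂ (inj₁ a)) (inj₁ b)        = ¬xy (inj₂ (a , b))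
      cases (inj₂ (inj₁ a)) (inj₂ (inj₁ b)) = p≢q (trans a (sym b))
      cases (inj₂ (inj₁ a)) (inj₂ (inj₂ b)) = ¬yz (inj₁ (a , b))
      cases (inj₂ (inj₂ a)) (inj₁ b)        = ¬xz (inj₂ (a , b))
      cases (inj₂ (inj₂ a)) (inj₂ (inj₁ b)) = ¬yz (inj₂ (a , b))
      cases (inj₂ (inj₂ a)) (inj₂ (inj₂ b)) = p≢q (trans a (sym b))

  ⟦⟧-product≤ : ∀ {A B C : Set} (a? : Dec A) (b? : Dec B) (c? : Dec C) {t} → 0ℤ ≤ t → (A → B → C → 1ℤ ≤ t) →
    ⟦ does a? ⟧ * (⟦ does b? ⟧ * ⟦ does c? ⟧) ≤ t
  ⟦⟧-product≤ (yes a) (yes b) (yes c) 0≤t 1≤t = 1≤t a b c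
  ⟦⟧-product≤ (no _)  b?      c?      0≤t 1≤t = ≤-trans (≤-reflexive (*-zeroˡ (⟦ does b? ⟧ * ⟦ does c? ⟧))) 0≤t
  ⟦⟧-product≤ (yes _) (no _)  c?      0≤t 1≤t = ≤-trans (≤-reflexive (cong (1ℤ *_) (*-zeroˡ ⟦ does c? ⟧))) 0≤t
  ⟦⟧-product≤ (yes _) (yes _) (no _)  0≤t 1≤t = 0≤t

  1-⟦⟧-⟦⟧≤ : ∀ {A B : Set} (a? : Dec A) (b? : Dec B) {t} → 0ℤ ≤ t → (¬ A → ¬ B → 1ℤ ≤ t) →
    1ℤ - ⟦ does a? ⟧ - ⟦ does b? ⟧ ≤ t
  1-⟦⟧-⟦⟧≤ (yes _) (yes _) 0≤t 1≤t = ≤-trans -≤+ 0≤t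
  1-⟦⟧-⟦⟧≤ (yes _) (no _)  0≤t 1≤t = 0≤t
  1-⟦⟧-⟦⟧≤ (no _)  (yes _) 0≤t 1≤t = 0≤t
  1-⟦⟧-⟦⟧≤ (no ¬a) (no ¬b) 0≤t 1≤t = 1≤t ¬a ¬b

  module _ {N m} {Class : Fin m → Subset N → Set} (shapes : ∀ i → Shape (Class i))
           (class : ∀ S → card S ≡ 3 → ∃ λ i → Class i S) where

    -- The graph H of the pairs that no shape uses.
    Adj : Fin N → Fin N → Set
    Adj x y = x ≢ y × (∀ i → ¬ Marks (shapes i) x y)

    adj? : ∀ x y → Dec (Adj x y)
    adj? x y = ¬? (x Fin.≟ y) ×-dec Fin.all? (λ i → ¬? (marks? (shapes i) x y))

    Adj-sym : ∀ {x y} → Adj x y → Adj y x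
    Adj-sym (x≢y , ¬m) = ≢-sym x≢y , λ i mk → ¬m i (Marks-sym (shapes i) mk)

    ∑-quads+pairs : ∑[ i < m ] quads (shapes i) + ∑[ i < m ] pairs (shapes i) ≡ + m
    ∑-quads+pairs = trans (sym (sum-+ {m} _ _)) (trans (sum-cong-≗ (λ i → quads+pairs (shapes i))) (trans (sum-const m 1ℤ) (*-identityʳ (+ m))))

    -- `β` counts the quads, so `m - β` counts the common pairs. Each triangle of H lies in some
    -- class, whose shape must then be a quad; each non-edge is marked by a common pair, which
    -- accounts for two ordered pairs.
    weights : PairTripleWeights N (+ m)
    weights = record
      { a = a
      ; a≡0∨1 = λ x y → 0∨1 (does (adj? x y))
      ; a-sym = λ x y → cong ⟦_⟧ (does-⇔ (mk⇔ Adj-sym Adj-sym) (adj? x y) (adj? y x))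
      ; a-irrefl = a-irrefl
      ; β = β
      ; h = h
      ; g = g
      ; ∑∑h = trans (sum-cong-≗ ∑h) (trans (sum-* (+ 6) g) (trans (cong (+ 6 *_) ∑g) (eq₂₄ β)))
      ; ∑h = ∑h
      ; codegree≤ = codegree≤
      ; nonadjacent = nonadjacent
      }
      where
      a : Fin N → Fin N → ℤ
      a x y = ⟦ does (adj? x y) ⟧
      0∨1 : ∀ b → ⟦ b ⟧ ≡ 0ℤ ⊎ ⟦ b ⟧ ≡ 1ℤ
      0∨1 false = inj₁ refl
      0∨1 true  = inj₂ refl
      a-irrefl : ∀ x → a x x ≡ 0ℤ
      a-irrefl x = cong ⟦_⟧ (dec-false (adj? x x) λ (x≢x , _) → x≢x refl)
      β : ℤ
      β = ∑[ i < m ] quads (shapes i)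
      h : Fin N → Fin N → ℤ
      h x y = ∑[ i < m ] edges (shapes i) x y
      g : Fin N → ℤ
      g x = ∑[ i < m ] corners (shapes i) x
      eq₆ : ∀ i → + 2 * (+ 3 * i) ≡ + 6 * i
      eq₆ = solve-∀
      eq₂₄ : ∀ i → + 6 * (+ 4 * i) ≡ + 24 * i
      eq₂₄ = solve-∀
      ∑g : sum g ≡ + 4 * β
      ∑g = trans (∑-comm (λ x i → corners (shapes i) x)) (trans (sum-cong-≗ (λ i → ∑-corners (shapes i))) (sum-* {m} (+ 4) _))
      ∑h : ∀ x → ∑[ y < N ] (+ 2 * h x y) ≡ + 6 * g x
      ∑h x = trans (sum-* (+ 2) (h x)) (trans (cong (+ 2 *_) (trans (∑-comm (λ y i → edges (shapes i) x y))
        (trans (sum-cong-≗ (λ i → ∑-edges (shapes i) x)) (sum-* {m} (+ 3) _)))) (eq₆ (g x)))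
      triangle : ∀ x y z → a x y * (a x z * a y z) ≤ ∑[ i < m ] faces (shapes i) x y z
      triangle x y z = ⟦⟧-product≤ (adj? x y) (adj? x z) (adj? y z) (0≤sum (λ i → 0≤faces (shapes i) x y z))
        λ (x≢y , ¬xy) (x≢z , ¬xz) (y≢z , ¬yz) → let i , xyz = class (triple x y z) (∣triple∣≡3 x≢y x≢z y≢z) in
          ≤-trans (1≤faces (shapes i) x≢y x≢z y≢z (¬xy i) (¬xz i) (¬yz i) xyz) (term≤sum (λ i → 0≤faces (shapes i) x y z) i)
      codegree≤ : ∀ x y → ∑[ z < N ] (a x y * (a x z * a y z)) ≤ + 2 * h x y
      codegree≤ x y = ≤-trans (sum-mono (triangle x y)) (≤-reflexive (trans (∑-comm (λ z i → faces (shapes i) x y z))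
        (trans (sum-cong-≗ (λ i → ∑-faces (shapes i) x y)) (sum-* {m} (+ 2) _))))
      non-edge : ∀ x y → 1ℤ - δ x y - a x y ≤ ∑[ i < m ] marks (shapes i) x y
      non-edge x y = 1-⟦⟧-⟦⟧≤ (x Fin.≟ y) (adj? x y) (0≤sum (λ i → 0≤marks (shapes i) x y)) λ x≢y ¬xy →
        let i , ¬¬mk = Fin.¬∀⟶∃¬ m _ (λ i → ¬? (marks? (shapes i) x y)) (λ ¬mk → ¬xy (x≢y , ¬mk)) in
        ≤-trans (1≤marks (shapes i) (decidable-stable (marks? (shapes i) x y) ¬¬mk)) (term≤sum (λ i → 0≤marks (shapes i) x y) i)
      eq-pairs : ∀ q p → + 2 * p ≡ + 2 * (q + p - q)
      eq-pairs = solve-∀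
      nonadjacent : ∑∑ (λ x y → 1ℤ - δ x y - a x y) ≤ + 2 * (+ m - β)
      nonadjacent = ≤-trans (sum-mono (λ x → sum-mono (non-edge x))) (≤-reflexive (begin
        ∑[ x < N ] ∑[ y < N ] ∑[ i < m ] marks (shapes i) x y
          ≡⟨ sum-cong-≗ (λ x → ∑-comm (λ y i → marks (shapes i) x y)) ⟩
        ∑[ x < N ] ∑[ i < m ] ∑[ y < N ] marks (shapes i) x y
          ≡⟨ ∑-comm (λ x i → ∑[ y < N ] marks (shapes i) x y) ⟩
        ∑[ i < m ] ∑∑ (marks (shapes i))
          ≡⟨ trans (sum-cong-≗ (λ i → ∑∑-marks (shapes i))) (sum-* {m} (+ 2) _) ⟩
        + 2 * ∑[ i < m ] pairs (shapes i)
          ≡⟨ trans (eq-pairs β _) (cong (λ s → + 2 * (s - β)) ∑-quads+pairs) ⟩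
        + 2 * (+ m - β) ∎))
        where open ≡-Reasoning

  module _ {N m} (C : CliqueCover (JAdj (suc N) 3) m) where
    open CliqueCover C

    -- Cliques of a cover are arbitrary predicates. Keeping in the `i`-th one only the triples that
    -- `covers` assigns to it makes membership decidable, and every triple still has a class.
    Class : Fin m → Subset (suc N) → Set
    Class i S = ∃ λ (∣S∣≡3 : card S ≡ 3) → proj₁ (covers (S , ∣S∣≡3)) ≡ i

    class-family : ∀ i → TripleFamily (Class i)
    class-family i = record { member? = member? ; size = proj₁ ; meet = meet }
      where
      member? : ∀ S → Dec (Class i S)
      member? S with card S ℕ.≟ 3
      ... | no ∣S∣≢3 = no λ c → ∣S∣≢3 (proj₁ c)
      ... | yes ∣S∣≡3 = map′ (∣S∣≡3 ,_) (λ (p , e) → trans (cong (λ p → proj₁ (covers (S , p))) (ℕ.≡-irrelevant ∣S∣≡3 p)) e)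
                             (proj₁ (covers (S , ∣S∣≡3)) Fin.≟ i)
      meet : ∀ {S T} → Class i S → Class i T → 2 ℕ.≤ card (S ∩ T)
      meet {S} {T} (s , refl) (t , e) with ≡-dec _≟ᵇ_ S T
      -- Equal members share three points; different ones are adjacent.
      ... | yes refl = ℕ.≤-trans (s≤s (s≤s z≤n)) (ℕ.≤-reflexive (sym (trans (cong card (∩-idem S)) s)))
      ... | no S≢T = ℕ.≤-reflexive (sym (isClique i (S , s) (T , t) (proj₂ (covers (S , s)))
        (subst (λ j → clique j (T , t)) e (proj₂ (covers (T , t)))) (λ eq → S≢T (cong proj₁ eq))))

    cover-weights : PairTripleWeights (suc N) (+ m)
    cover-weights = weights (λ i → shape (class-family i) zero) (λ S ∣S∣≡3 → proj₁ (covers (S , ∣S∣≡3)) , ∣S∣≡3 , refl)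

open Triples
open Weights using (bound₅; weights-bound-odd; weights-bound-even; cover-weights)
open import Data.Fin.Subset using (∣_∣)
import Data.Integer.Properties as ℤ
open import Data.List.Base using (List; []; _∷_; _++_; map; length; lookup)
import Data.List.Membership.Propositional as List
open import Data.List.Membership.Propositional.Properties using (∈-++⁺ˡ; ∈-++⁺ʳ; ∈-++⁻; ∈-map⁺; ∈-map⁻; ∈-lookup)
open import Data.List.Properties using (length-++; length-map)
open import Data.List.Relation.Unary.Any using (here; there; index)
open import Data.List.Relation.Unary.Any.Properties using (lookup-index)
open import Data.Nat using (ℕ; _<_; _∸_; _*_; _+_; _≤_)
open import Data.Nat.Divisibility using (divides-refl)
open import Data.Nat.DivMod using (_/_; +-distrib-/-∣ʳ; m*n/n≡m)
open import Data.Nat.Tactic.RingSolver using (solve-∀)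
open import Data.Unit.Base using (⊤; tt)
open import Data.Vec.Base using ([]; _∷_; here; there)
open import Relation.Binary.Definitions using (tri<; tri≈; tri>)

-- The quotient by 4, and the lower bound for covers.

[a+b*4]/4≡a/4+b : ∀ a b → (a + b * 4) / 4 ≡ a / 4 + b
[a+b*4]/4≡a/4+b a b = trans (+-distrib-/-∣ʳ a (divides-refl b)) (cong (λ c → a / 4 + c) (m*n/n≡m b 4))

even-square/4 : ∀ k → ((2 * k) * (2 * k)) / 4 ≡ k * k
even-square/4 k = trans (cong (_/ 4) (eq k)) ([a+b*4]/4≡a/4+b 0 (k * k))
  where eq : ∀ k → (2 * k) * (2 * k) ≡ k * k * 4
        eq = solve-∀

odd-square/4 : ∀ k → (suc (2 * k) * suc (2 * k)) / 4 ≡ k * k + k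
odd-square/4 k = trans (cong (_/ 4) (eq k)) ([a+b*4]/4≡a/4+b 1 (k * k + k))
  where eq : ∀ k → suc (2 * k) * suc (2 * k) ≡ 1 + (k * k + k) * 4
        eq = solve-∀

even⊎odd : ∀ n → (∃ λ k → n ≡ 2 * k) ⊎ (∃ λ k → n ≡ suc (2 * k))
even⊎odd zero = inj₁ (0 , refl)
even⊎odd (suc n) with even⊎odd n
... | inj₁ (k , refl) = inj₂ (k , refl)
... | inj₂ (k , refl) = inj₁ (suc k , sym (ℕ.*-suc 2 k))

cover-bound : ∀ N {m} → 5 < N → CliqueCover (JAdj N 3) m → ((N ∸ 1) * (N ∸ 1)) / 4 ≤ m
cover-bound (suc n) {m} 5<N C with even⊎odd n
... | inj₁ (k , refl) = subst (_≤ m) (sym (even-square/4 k)) (weights-bound-odd k 5<N (cover-weights C))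
... | inj₂ (k , refl) = subst (_≤ m) (sym (odd-square/4 k)) (weights-bound-even k 5<N (cover-weights C))

-- Upper bound: pairs of equal parity.

-- The third point of `S` is not in `T`, since otherwise both sets would consist of the same three
-- points.
adjacent-via-pair : ∀ {n} {S T : Subset n} {x y} → ∣ S ∣ ≡ 3 → ∣ T ∣ ≡ 3 → S ≢ T → x ≢ y →
  x ∈ S → y ∈ S → x ∈ T → y ∈ T → ∣ S ∩ T ∣ ≡ 2
adjacent-via-pair {S = S} {T} {x} {y} s t S≢T x≢y x∈S y∈S x∈T y∈T with third s x∈S y∈S x≢y
... | c , S≡xyc = trans (cong ∣_∣ (⊆-antisym S∩T⊆xy xy⊆S∩T)) (trans (∣⁅x⁆∪p∣≡1+∣p∣ (x≢y⇒x∉⁅y⁆ x≢y)) (cong suc (∣⁅x⁆∣≡1 y)))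
  where
  open Enumerates S≡xyc using (complete; c∈S; a≢c; b≢c)
  c∉T : c ∉ T
  c∉T c∈T = S≢T (⊆-antisym S⊆T T⊆S)
    where
    S⊆T : S ⊆ T
    S⊆T z∈ with complete z∈
    ... | inj₁ refl        = x∈T
    ... | inj₂ (inj₁ refl) = y∈T
    ... | inj₂ (inj₂ refl) = c∈T
    T⊆S : T ⊆ S
    T⊆S z∈ with Enumerates.complete (enumerates t x∈T y∈T c∈T x≢y a≢c b≢c) z∈
    ... | inj₁ refl        = x∈S
    ... | inj₂ (inj₁ refl) = y∈S
    ... | inj₂ (inj₂ refl) = c∈S
  S∩T⊆xy : S ∩ T ⊆ ⁅ x ⁆ ∪ ⁅ y ⁆
  S∩T⊆xy z∈ with x∈p∩q⁻ S T z∈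
  ... | z∈S , z∈T with complete z∈S
  ...   | inj₁ refl        = x∈p∪q⁺ (inj₁ (x∈⁅x⁆ x))
  ...   | inj₂ (inj₁ refl) = x∈p∪q⁺ {p = ⁅ x ⁆} (inj₂ (x∈⁅x⁆ y))
  ...   | inj₂ (inj₂ refl) = contradiction z∈T c∉T
  xy⊆S∩T : ⁅ x ⁆ ∪ ⁅ y ⁆ ⊆ S ∩ T
  xy⊆S∩T z∈ with x∈p∪q⁻ ⁅ x ⁆ _ z∈
  ... | inj₁ z∈x = subst (_∈ S ∩ T) (sym (x∈⁅y⁆⇒x≡y x z∈x)) (x∈p∩q⁺ (x∈S , x∈T))
  ... | inj₂ z∈y = subst (_∈ S ∩ T) (sym (x∈⁅y⁆⇒x≡y y z∈y)) (x∈p∩q⁺ (y∈S , y∈T))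

≢⇒proj₁≢ : ∀ {N k} {u v : JVertex N k} → u ≢ v → proj₁ u ≢ proj₁ v
≢⇒proj₁≢ {u = S , p} {.S , q} u≢v refl = u≢v (cong (S ,_) (ℕ.≡-irrelevant p q))

-- Only the smaller numbers of the same parity as the argument.
below : ℕ → List ℕ
below 0             = []
below 1             = []
below (suc (suc n)) = n ∷ below n

same-parity-pairs : ℕ → List (ℕ × ℕ)
same-parity-pairs 0       = []
same-parity-pairs (suc n) = map (n ,_) (below n) ++ same-parity-pairs n

-- The two lists have opposite parities and together contain each number less than `n` once.
length-below : ∀ n → length (below (suc n)) + length (below n) ≡ n
length-below zero    = refl
length-below (suc n) = cong suc (trans (ℕ.+-comm (length (below n)) _) (length-below n))

length-same-parity-pairs-suc : ∀ n → length (same-parity-pairs (suc n)) ≡ length (below n) + length (same-parity-pairs n)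
length-same-parity-pairs-suc n = trans (length-++ (map (n ,_) (below n))) (cong (_+ length (same-parity-pairs n)) (length-map (n ,_) (below n)))

-- Induction in steps of two: by `length-below` such a step adds `suc n` pairs, and
-- `(n + 2)² = n² + 4 (n + 1)`.
length-same-parity-pairs : ∀ n → length (same-parity-pairs (suc n)) ≡ (n * n) / 4
length-same-parity-pairs 0             = refl
length-same-parity-pairs 1             = refl
length-same-parity-pairs (suc (suc n)) =
  trans (length-same-parity-pairs-suc (2 + n)) (trans (cong (λ l → length (below (2 + n)) + l) (length-same-parity-pairs-suc (suc n)))
  (trans (sym (ℕ.+-assoc (length (below (2 + n))) _ _)) (trans (cong₂ _+_ (length-below (suc n)) (length-same-parity-pairs n))
  (trans (ℕ.+-comm (suc n) _) (sym (trans (cong (_/ 4) (eq n)) ([a+b*4]/4≡a/4+b (n * n) (suc n))))))))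
  where eq : ∀ n → suc (suc n) * suc (suc n) ≡ n * n + suc n * 4
        eq = solve-∀

∈-below⇒< : ∀ n {i} → i List.∈ below n → i < n
∈-below⇒< (suc (suc n)) (here refl) = ℕ.m≤n⇒m≤1+n ℕ.≤-refl
∈-below⇒< (suc (suc n)) (there i∈)  = ℕ.m≤n⇒m≤1+n (ℕ.m≤n⇒m≤1+n (∈-below⇒< n i∈))

∈-same-parity-pairs⇒> : ∀ n {i j} → (j , i) List.∈ same-parity-pairs n → i < j
∈-same-parity-pairs⇒> (suc n) ji∈ with ∈-++⁻ (map (n ,_) (below n)) ji∈
... | inj₂ ji∈′ = ∈-same-parity-pairs⇒> n ji∈′
... | inj₁ ji∈′ with ∈-map⁻ (n ,_) ji∈′
...   | i , i∈ , refl = ∈-below⇒< n i∈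

odd : ℕ → Bool
odd zero    = false
odd (suc n) = not (odd n)

∈-below : ∀ {i} j → i < j → odd i ≡ odd j → i List.∈ below j
∈-below {zero} 1 _ ()
∈-below {suc i} 1 (s≤s ()) _
∈-below {i} (suc (suc j)) i<2+j eq with ℕ.m≤n⇒m<n∨m≡n i<2+j
-- Here `i` is `suc j`, which has the wrong parity.
... | inj₂ refl = contradiction eq (not-¬ refl)
... | inj₁ (s≤s i<1+j) with ℕ.m≤n⇒m<n∨m≡n i<1+j
...   | inj₂ refl = here refl
...   | inj₁ (s≤s i<j) = there (∈-below j i<j (trans eq (not-involutive (odd j))))

∈-same-parity-pairs : ∀ n {i j} → i < j → j < n → odd i ≡ odd j → (j , i) List.∈ same-parity-pairs n
∈-same-parity-pairs (suc n) {i} {j} i<j j<1+n eq with ℕ.m≤n⇒m<n∨m≡n j<1+n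
... | inj₂ refl      = ∈-++⁺ˡ (∈-map⁺ (n ,_) (∈-below n i<j eq))
... | inj₁ (s≤s j<n) = ∈-++⁺ʳ (map (n ,_) (below n)) (∈-same-parity-pairs n i<j j<n eq)

bool-pigeonhole : ∀ (a b c : Bool) → a ≡ b ⊎ a ≡ c ⊎ b ≡ c
bool-pigeonhole false false _     = inj₁ refl
bool-pigeonhole true  true  _     = inj₁ refl
bool-pigeonhole false true  false = inj₂ (inj₁ refl)
bool-pigeonhole true  false true  = inj₂ (inj₁ refl)
bool-pigeonhole false true  true  = inj₂ (inj₂ refl)
bool-pigeonhole true  false false = inj₂ (inj₂ refl)

same-parity-cover : ∀ N → CliqueCover (JAdj N 3) (length (same-parity-pairs N))
same-parity-cover N = record { clique = clique ; isClique = isClique ; covers = covers }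
  where
  chosen : List (ℕ × ℕ)
  chosen = same-parity-pairs N

  Contains : Subset N → ℕ → Set
  Contains S k = ∃ λ x → x ∈ S × toℕ x ≡ k

  clique : Fin (length chosen) → JVertex N 3 → Set
  clique i (S , _) = Contains S (proj₁ (lookup chosen i)) × Contains S (proj₂ (lookup chosen i))

  isClique : ∀ i → IsClique (JAdj N 3) (clique i)
  isClique i (S , s) (T , t) ((x , x∈S , x≡) , (y , y∈S , y≡)) ((x′ , x′∈T , x′≡) , (y′ , y′∈T , y′≡)) u≢v =
    adjacent-via-pair s t (≢⇒proj₁≢ u≢v) x≢y x∈S y∈S
      (subst (_∈ T) (Fin.toℕ-injective (trans x′≡ (sym x≡))) x′∈T) (subst (_∈ T) (Fin.toℕ-injective (trans y′≡ (sym y≡))) y′∈T)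
    where
    x≢y : x ≢ y
    x≢y refl = ℕ.<-irrefl (trans (sym y≡) x≡) (∈-same-parity-pairs⇒> N (∈-lookup {xs = chosen} i))

  clique-of : ∀ {S} (s : ∣ S ∣ ≡ 3) {x y} → x ∈ S → y ∈ S → x ≢ y → odd (toℕ x) ≡ odd (toℕ y) → ∃ λ i → clique i (S , s)
  clique-of {S} s {x} {y} x∈S y∈S x≢y eq with ℕ.<-cmp (toℕ x) (toℕ y)
  ... | tri≈ _ x≡y _ = contradiction (Fin.toℕ-injective x≡y) x≢y
  ... | tri< x<y _ _ = index yx∈ , subst (λ p → Contains S (proj₁ p) × Contains S (proj₂ p)) (lookup-index yx∈) ((y , y∈S , refl) , (x , x∈S , refl))
    where yx∈ = ∈-same-parity-pairs N x<y (Fin.toℕ<n y) eq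
  ... | tri> _ _ y<x = index xy∈ , subst (λ p → Contains S (proj₁ p) × Contains S (proj₂ p)) (lookup-index xy∈) ((x , x∈S , refl) , (y , y∈S , refl))
    where xy∈ = ∈-same-parity-pairs N y<x (Fin.toℕ<n x) (sym eq)

  covers : ∀ v → ∃ λ i → clique i v
  covers (S , s) with enumerate s
  ... | a , b , c , enumerates _ a∈S b∈S c∈S a≢b a≢c b≢c with bool-pigeonhole (odd (toℕ a)) (odd (toℕ b)) (odd (toℕ c))
  ...   | inj₁ eq        = clique-of s a∈S b∈S a≢b eq
  ...   | inj₂ (inj₁ eq) = clique-of s a∈S c∈S a≢c eq
  ...   | inj₂ (inj₂ eq) = clique-of s b∈S c∈S b≢c eq

-- Covers for `N = 4` and `N = 5`, and the theorem.

-- Different triples omit different points of the four, so two points remain in common; checked by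
-- search over all pairs of subsets.
J[4,3]-complete : ∀ {S T : Subset 4} → ∣ S ∣ ≡ 3 → ∣ T ∣ ≡ 3 → S ≢ T → ∣ S ∩ T ∣ ≡ 2
J[4,3]-complete {S} {T} s t S≢T = decidable-stable (∣ S ∩ T ∣ ℕ.≟ 2) λ ≢2 → no-counterexample (S , T , s , t , S≢T , ≢2)
  where
  no-counterexample : ¬ (∃ λ (S : Subset 4) → ∃ λ (T : Subset 4) → ∣ S ∣ ≡ 3 × ∣ T ∣ ≡ 3 × S ≢ T × ∣ S ∩ T ∣ ≢ 2)
  no-counterexample = from-no (anySubset? λ (S : Subset 4) → anySubset? λ (T : Subset 4) →
    (∣ S ∣ ℕ.≟ 3) ×-dec (∣ T ∣ ℕ.≟ 3) ×-dec ¬? (≡-dec _≟ᵇ_ S T) ×-dec ¬? (∣ S ∩ T ∣ ℕ.≟ 2))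

cover₄ : CliqueCover (JAdj 4 3) 1
cover₄ = record
  { clique   = λ _ _ → ⊤
  ; isClique = λ { _ (S , s) (T , t) _ _ u≢v → J[4,3]-complete s t (≢⇒proj₁≢ u≢v) }
  ; covers   = λ _ → zero , tt
  }

cover₅ : CliqueCover (JAdj 5 3) 3
cover₅ = record { clique = clique ; isClique = isClique ; covers = covers }
  where
  clique : Fin 3 → JVertex 5 3 → Set
  clique zero             (S , _) = ∃ λ S′ → S ≡ outside ∷ S′
  clique (suc zero)       (S , _) = ∃ λ S′ → S ≡ inside ∷ outside ∷ S′
  clique (suc (suc zero)) (S , _) = zero ∈ S × suc zero ∈ S

  isClique : ∀ i → IsClique (JAdj 5 3) (clique i)
  isClique zero (_ , s) (_ , t) (S′ , refl) (T′ , refl) u≢v =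
    J[4,3]-complete s t (λ eq → ≢⇒proj₁≢ u≢v (cong (outside ∷_) eq))
  -- Deleting the coordinate 1, absent from both sets, leaves triples in four points.
  isClique (suc zero) (_ , s) (_ , t) (S′ , refl) (T′ , refl) u≢v =
    J[4,3]-complete {inside ∷ S′} {inside ∷ T′} s t (λ { refl → ≢⇒proj₁≢ u≢v refl })
  isClique (suc (suc zero)) (S , s) (T , t) (p , q) (p′ , q′) u≢v =
    adjacent-via-pair s t (≢⇒proj₁≢ u≢v) (λ ()) p q p′ q′

  covers : ∀ v → ∃ λ i → clique i v
  covers (outside ∷ S , _)          = zero , S , refl
  covers (inside ∷ outside ∷ S , _) = suc zero , S , refl
  covers (inside ∷ inside ∷ S , _)  = suc (suc zero) , here , there here

-- Some clique has to contain the vertex exhibited, so `Fin m` is inhabited.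
cover-bound₄ : ∀ m → CliqueCover (JAdj 4 3) m → 1 ≤ m
cover-bound₄ m C = ℕ.≤-trans (s≤s z≤n) (Fin.toℕ<n (proj₁ (CliqueCover.covers C (inside ∷ inside ∷ inside ∷ outside ∷ [] , refl))))

theorem2p7 : CliqueCoverNumber (JAdj 4 3) 1
    × CliqueCoverNumber (JAdj 5 3) 3
    × (∀ (N : ℕ) → 5 < N → CliqueCoverNumber (JAdj N 3) (((N ∸ 1) * (N ∸ 1)) / 4))
theorem2p7 = (cover₄ , cover-bound₄) , (cover₅ , λ m C → ℤ.drop‿+≤+ (bound₅ (cover-weights C))) , general
  where
  general : ∀ N → 5 < N → CliqueCoverNumber (JAdj N 3) (((N ∸ 1) * (N ∸ 1)) / 4)
  general (suc n) 5<N = subst (CliqueCover (JAdj (suc n) 3)) (length-same-parity-pairs n) (same-parity-cover (suc n)) , λ m → cover-bound (suc n) 5<N
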